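{- A graph is an edge extremal minimal bipartite matching covered graph if and only if it is obtained from a star by isomorphic leaf matching.
   Context: All graphs are finite and loopless; parallel edges are allowed. For a graph $G=(V,E)$ write $n=|V|$. A connected graph on four or more vertices is matching covered if every edge lies in some perfect matching. A matching covered graph is minimal if deleting any single edge yields a graph that is not matching covered. A minimal bipartite matching covered graph is edge extremal if $|E|=\frac{3n-6}{2}$. A star is $K_{1,p}$ with $p\geq 2$. A graph $H$ is obtained from a tree $T$ (on at least two vertices) by isomorphic leaf matching if, for a disjoint copy $T'$ of $T$ and some fixed isomorphism from $T$ to $T'$, $H$ is obtained from $T\cup T'$ by adding, for each leaf of $T$, one edge joining this leaf to the corresponding leaf of $T'$ under the isomorphism. -}

module Defs where

open import Data.Bool.Base using (Bool)
open import Data.Fin.Base using (Fin; zero; suc; _↑ˡ_; _↑ʳ_; splitAt; punchIn)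
open import Data.Fin.Properties using (_≟_; ↑ˡ-injective; ↑ʳ-injective; splitAt-↑ˡ; splitAt-↑ʳ)
open import Data.Fin.Subset using (Subset; _∈_)
open import Data.List.Base using (List; []; _∷_; allFin; filter; length; lookup)
open import Data.List.Relation.Unary.Unique.Propositional using (Unique)
open import Data.Nat.Base using (ℕ; zero; suc; _+_; _*_; _≤_)
import Data.Nat.Properties as ℕ
open import Data.Product.Base using (Σ-syntax; ∃-syntax; _×_; _,_; proj₁; proj₂)
open import Data.Product using (∃!)
open import Data.Sum.Base using (_⊎_; inj₁; inj₂; map₂)
open import Function.Base using (_∘_)
open import Function.Bundles using (_↔_; Inverse)
open import Relation.Binary.Construct.Closure.ReflexiveTransitive using (Star; ε; _◅_)
open import Relation.Binary.PropositionalEquality using (_≡_; _≢_; refl; sym; trans; cong)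
open import Relation.Nullary using (¬_; Dec)
open import Relation.Nullary.Decidable using (_⊎-dec_)

-- Finite loopless multigraphs.  Edges are undirected: the order of the two
-- components of `ends e` is an artefact of the encoding, which every notion
-- below (isomorphism in particular) ignores.
record Graph : Set where
  constructor mkGraph
  field
    order    : ℕ
    size     : ℕ
    ends     : Fin size → Fin order × Fin order
    loopless : ∀ e → proj₁ (ends e) ≢ proj₂ (ends e)

  V : Set
  V = Fin order

  E : Set
  E = Fin size

  Joins : E → V → V → Set
  Joins e u v = ends e ≡ (u , v) ⊎ ends e ≡ (v , u)

  Incident : E → V → Set
  Incident e v = proj₁ (ends e) ≡ v ⊎ proj₂ (ends e) ≡ v

  incident? : ∀ v e → Dec (Incident e v)
  incident? v e = (proj₁ (ends e) ≟ v) ⊎-dec (proj₂ (ends e) ≟ v)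

  degree : V → ℕ
  degree v = length (filter (incident? v) (allFin size))

  Adjacent : V → V → Set
  Adjacent u v = ∃[ e ] Joins e u v

  Walk : V → V → Set
  Walk = Star Adjacent

  walkEdges : ∀ {u v} → Walk u v → List E
  walkEdges ε             = []
  walkEdges ((e , _) ◅ w) = e ∷ walkEdges w

  -- All vertices visited, except the final one.
  walkVertices : ∀ {u v} → Walk u v → List V
  walkVertices         ε       = []
  walkVertices {u = u} (_ ◅ w) = u ∷ walkVertices w

  -- Requiring distinct edges rules out going back and forth along one edge,
  -- while two parallel edges do form a cycle.
  IsCycle : ∀ {v} → Walk v v → Set
  IsCycle w = walkEdges w ≢ [] × Unique (walkEdges w) × Unique (walkVertices w)

  leaves : List V
  leaves = filter (λ v → degree v ℕ.≟ 1) (allFin order)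

open Graph public using (order; size)

Connected : Graph → Set
Connected G = ∀ u v → Walk u v
  where open Graph G

Acyclic : Graph → Set
Acyclic G = ∀ {v} (w : Walk v v) → ¬ IsCycle w
  where open Graph G

Bipartite : Graph → Set
Bipartite G = Σ[ colour ∈ (V → Bool) ] (∀ e → colour (proj₁ (ends e)) ≢ colour (proj₂ (ends e)))
  where open Graph G

PerfectMatching : (G : Graph) → Subset (size G) → Set
PerfectMatching G M = ∀ v → ∃! _≡_ (λ e → e ∈ M × Incident e v)
  where open Graph G

record MatchingCovered (G : Graph) : Set where
  field
    4≤order   : 4 ≤ order G
    connected : Connected G
    covered   : ∀ (e : Fin (size G)) → ∃[ M ] PerfectMatching G M × e ∈ M

deleteEdge : (G : Graph) → Fin (size G) → Graph
deleteEdge (mkGraph n zero    ends loopless) ()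
deleteEdge (mkGraph n (suc m) ends loopless) e =
  mkGraph n m (ends ∘ punchIn e) (loopless ∘ punchIn e)

MinimalMatchingCovered : Graph → Set
MinimalMatchingCovered G =
  MatchingCovered G × (∀ (e : Fin (size G)) → ¬ MatchingCovered (deleteEdge G e))

record EdgeExtremalMinimalBipartiteMatchingCovered (G : Graph) : Set where
  field
    minimal      : MinimalMatchingCovered G
    bipartite    : Bipartite G
    -- |E| = (3n - 6) / 2, free of division and truncated subtraction.
    edgeExtremal : 2 * size G + 6 ≡ 3 * order G

infix 4 _≅_

record _≅_ (G H : Graph) : Set where
  private
    module G = Graph G
    module H = Graph H
  field
    vertices : G.V ↔ H.V
    edges    : G.E ↔ H.E
    respects : ∀ e → H.Joins (Inverse.to edges e)
                             (Inverse.to vertices (proj₁ (G.ends e)))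
                             (Inverse.to vertices (proj₂ (G.ends e)))

record Tree (T : Graph) : Set where
  field
    2≤order   : 2 ≤ order T
    connected : Connected T
    acyclic   : Acyclic T

-- The complete bipartite graph K₁,ₚ, with centre `zero`.
K₁, : ℕ → Graph
K₁, p = mkGraph (suc p) p (λ i → zero , suc i) (λ _ ())

IsStar : Graph → Set
IsStar T = ∃[ p ] 2 ≤ p × T ≅ K₁, p

-- The disjoint union T ∪ T′ together with, for each leaf ℓ of T, one new edge
-- joining ℓ to its image under φ.
module LeafMatching (T T′ : Graph) (φ : T ≅ T′) where
  private
    module T  = Graph T
    module T′ = Graph T′

  Leaf : Set
  Leaf = Fin (length T.leaves)

  left : T.V → Fin (order T + order T′)
  left v = v ↑ˡ order T′

  right : T′.V → Fin (order T + order T′)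
  right v = order T ↑ʳ v

  left≢right : ∀ u v → left u ≢ right v
  left≢right u v eq
    with () ← trans (sym (splitAt-↑ˡ (order T) u (order T′)))
                    (trans (cong (splitAt (order T)) eq)
                           (splitAt-↑ʳ (order T) (order T′) v))

  endsOf : T.E ⊎ T′.E ⊎ Leaf → Fin (order T + order T′) × Fin (order T + order T′)
  endsOf (inj₁ e)        = left (proj₁ (T.ends e)) , left (proj₂ (T.ends e))
  endsOf (inj₂ (inj₁ e)) = right (proj₁ (T′.ends e)) , right (proj₂ (T′.ends e))
  endsOf (inj₂ (inj₂ i)) = left ℓ , right (Inverse.to (_≅_.vertices φ) ℓ)
    where ℓ = lookup T.leaves i

  endsOf-loopless : ∀ x → proj₁ (endsOf x) ≢ proj₂ (endsOf x)
  endsOf-loopless (inj₁ e)        = T.loopless e ∘ ↑ˡ-injective (order T′) _ _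
  endsOf-loopless (inj₂ (inj₁ e)) = T′.loopless e ∘ ↑ʳ-injective (order T) _ _
  endsOf-loopless (inj₂ (inj₂ i)) = left≢right _ _

  split : Fin (size T + (size T′ + length T.leaves)) → T.E ⊎ T′.E ⊎ Leaf
  split = map₂ (splitAt (size T′)) ∘ splitAt (size T)

  graph : Graph
  graph = mkGraph (order T + order T′) (size T + (size T′ + length T.leaves))
                  (endsOf ∘ split) (endsOf-loopless ∘ split)

_IsObtainedByIsomorphicLeafMatchingFrom_ : Graph → Graph → Set
H IsObtainedByIsomorphicLeafMatchingFrom T =
  Tree T × (∃[ T′ ] Σ[ φ ∈ T ≅ T′ ] H ≅ LeafMatching.graph T T′ φ)

module Submission where

-- Fixing a perfect matching of a bipartite graph with k white vertices and
-- contracting it turns the remaining edges into arcs of a digraph D on k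
-- vertices, which is strongly connected iff the graph is matching covered.
-- Minimality forbids detours around an arc of D, for every choice of the
-- matching.  Contracting a strongly connected part (S , F) of D and taking an
-- in- and an out-tree then gives |E| ≤ |F| + 3k ∸ 2|S|, so edge extremality
-- 2|E| + 6 = 3n forces 2|S| ≤ |F| + 3.  Hence cycles of D have length at most 3
-- and two triangles never meet in exactly one vertex; 2-cycles are excluded by
-- exchanging the matching along the corresponding 4-cycle.  So all triangles
-- share one arc, and G consists of internally disjoint paths of length 3
-- between two vertices, which is what leaf matching of a star produces.

-- Density alone cannot exclude 2-cycles: `|S| = |F| = 2` only gives 4 ≤ 5. The digraph of a fixed
-- matching also cannot express the deletion of a matching edge, so loops escape the detour
-- argument. Exchanging the matching along the 4-cycle turns the loop at an end of the 2-cycle into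
-- an ordinary arc; an ear of the 2-cycle then bypasses either this arc or an arc of the 2-cycle
-- itself. For the other configurations the constant 3 is exact: a triangle gives 6 ≤ 6 and two
-- triangles with a common arc give 8 ≤ 8, whereas a 4-cycle would need 8 ≤ 7 and two triangles with
-- one common vertex 10 ≤ 9. If e₁ → e₀ is the shared arc, the hubs are white e₀ and black e₁. A
-- further vertex v yields the path white e₀, black v, white v, black e₁; the shared arc and the
-- loops at its ends yield one more, so k vertices give k - 1 paths.

open import Defs
open import Data.Bool.Base using (Bool; true; false; not)
open import Data.Bool.Properties using (not-involutive; not-¬)
import Data.Bool.Properties as Bool
open import Data.Empty using (⊥)
open import Data.Fin.Base using (Fin; zero; suc; toℕ; fromℕ<; punchIn; punchOut)
open import Data.Fin.Patterns using (0F; 1F; 2F)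
open import Data.Fin.Permutation using (transpose; ↔⇒≡)
open import Data.Fin.Permutation.Components using () renaming (transpose to swapped; transpose-inverse to swapped-inverse)
open import Data.Fin.Properties
  using (_≟_; any?; all?; pigeonhole; ¬∀⟶∃¬; punchOut-injective; punchIn-punchOut; punchIn-injective; punchInᵢ≢i; *↔×; +↔⊎; 2↔Bool)
open import Data.Fin.Subset using (Subset) renaming (_∈_ to _∈ₛ_)
open import Data.List.Base using (List; []; _∷_; _++_; allFin; filter; length; lookup; map)
import Data.List.Membership.DecPropositional as DecMembership
open import Data.List.Membership.Propositional using (_∈_; _∉_)
open import Data.List.Membership.Propositional.Properties
  using (∈-lookup; ∈-length; ∈-allFin; ∈-++⁺ˡ; ∈-++⁺ʳ; ∈-map⁺; ∈-filter⁺; ∈-filter⁻)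
open import Data.List.Properties using (length-++; length-map; length-tabulate)
open import Data.List.Relation.Binary.Subset.Propositional using (_⊆_)
import Data.List.Relation.Unary.All as All
open import Data.List.Relation.Unary.All using (All; []; _∷_)
open import Data.List.Relation.Unary.All.Properties using (¬Any⇒All¬)
open import Data.List.Relation.Unary.AllPairs using ([]; _∷_)
open import Data.List.Relation.Unary.Any using (here; there; index)
open import Data.List.Relation.Unary.Any.Properties using (lookup-index)
open import Data.List.Relation.Unary.Unique.Propositional using (Unique)
open import Data.List.Relation.Unary.Unique.Propositional.Properties using (allFin⁺; filter⁺)
open import Data.Maybe.Base using (Maybe; just; nothing)
open import Data.Maybe.Properties using (just-injective)
open import Data.Nat.Base using (ℕ; zero; suc; _+_; _*_; _≤_; _<_; s≤s; s≤s⁻¹; s<s⁻¹)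
import Data.Nat.Properties as ℕ
open import Data.Nat.Solver using (module +-*-Solver)
open import Data.Product.Base using (Σ-syntax; ∃-syntax; _×_; _,_; proj₁; proj₂)
open import Data.Product.Function.NonDependent.Propositional using (_×-↔_)
open import Data.Sum.Base using (_⊎_; inj₁; inj₂; swap)
open import Data.Sum.Function.Propositional using (_⊎-↔_)
open import Data.Sum.Properties using (inj₁-injective; inj₂-injective)
open import Data.Unit.Base using (⊤; tt)
open import Data.Vec.Base using (tabulate)
open import Data.Vec.Properties using (lookup∘tabulate; []=⇒lookup; lookup⇒[]=)
open import Function.Base using (_∘_; id)
open import Function.Bundles using (_⇔_; _↔_; Inverse; mk⇔; mk⤖; mk↔ₛ′)
open import Function.Definitions using (Injective)
open import Function.Properties.Bijection using (⤖⇒↔)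
open import Function.Properties.Inverse using (↔-refl; ↔-sym; ↔-trans)
import Relation.Binary.Construct.Closure.ReflexiveTransitive as Star
open Star using (Star; ε; _◅_; _◅◅_)
open import Relation.Binary.PropositionalEquality
open import Relation.Nullary using (¬_; Dec; yes; no; contradiction; does)
open import Relation.Nullary.Decidable using (¬?; decidable-stable; dec-true)
open import Relation.Unary using (Decidable)

-- Finite sets

private
  variable
    A : Set
    n : ℕ

open module ∈? {n} = DecMembership (_≟_ {n}) using (_∈?_)

lookup-injective : {xs : List A} → Unique xs → ∀ i j → lookup xs i ≡ lookup xs j → i ≡ j
lookup-injective (x∉ ∷ u) zero    zero    eq = refl
lookup-injective (x∉ ∷ u) zero    (suc j) eq = contradiction eq (All.lookup x∉ (∈-lookup j))
lookup-injective (x∉ ∷ u) (suc i) zero    eq = contradiction (sym eq) (All.lookup x∉ (∈-lookup i))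
lookup-injective (x∉ ∷ u) (suc i) (suc j) eq = cong suc (lookup-injective u i j eq)

Unique⇒length≤ : {xs ys : List A} → Unique xs → xs ⊆ ys → length xs ≤ length ys
Unique⇒length≤ {xs = xs} {ys} u xs⊆ys = ℕ.≮⇒≥ λ lt →
  let f i = xs⊆ys (∈-lookup i)
      i , j , i<j , eq = pigeonhole lt (index ∘ f)
      same = trans (lookup-index (f i)) (trans (cong (lookup ys) eq) (sym (lookup-index (f j))))
  in ℕ.<⇒≢ i<j (cong toℕ (lookup-injective u i j same))

length-allFin : ∀ n → length (allFin n) ≡ n
length-allFin n = length-tabulate id

Unique-Fin : {xs : List (Fin n)} → Unique xs → length xs ≤ n
Unique-Fin {n} {xs} u = subst (length xs ≤_) (length-allFin n) (Unique⇒length≤ u λ _ → ∈-allFin _)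

injective⇒surjective : (f : Fin n → Fin n) → Injective _≡_ _≡_ f → ∀ y → ∃[ x ] f x ≡ y
injective⇒surjective {suc n} f inj y with any? (λ x → f x ≟ y)
... | yes found = found
... | no none =
  let y≢f i = λ eq → none (i , sym eq)
      i , j , i<j , eq = pigeonhole (ℕ.n<1+n n) (λ i → punchOut (y≢f i))
  in contradiction (cong toℕ (inj (punchOut-injective (y≢f i) (y≢f j) eq))) (ℕ.<⇒≢ i<j)

iterate : (A → A) → ℕ → A → A
iterate f zero    x = x
iterate f (suc j) x = f (iterate f j x)

-- Pigeonhole gives two equal iterates; injectivity then strips the applications of `f` that both
-- have in common.
orbit-returns : (f : Fin n → Fin n) → Injective _≡_ _≡_ f → ∀ x → ∃[ j ] iterate f (suc j) x ≡ x
orbit-returns {n} f inj x =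
  let i , j , i<j , eq = pigeonhole (ℕ.n<1+n n) (λ i → iterate f (toℕ i) x)
  in cancel (toℕ i) (toℕ j) i<j eq
  where
  cancel : ∀ i j → i < j → iterate f i x ≡ iterate f j x → ∃[ d ] iterate f (suc d) x ≡ x
  cancel zero    (suc j) _   eq = j , sym eq
  cancel (suc i) (suc j) i<j eq = cancel i j (s<s⁻¹ i<j) (inj eq)

-- Strongly connected digraphs

module Digraph {k m : ℕ} (src tgt : Fin m → Fin k) where

  Step : (Fin m → Set) → Fin k → Fin k → Set
  Step P u v = ∃[ e ] P e × src e ≡ u × tgt e ≡ v

  Reach : (Fin m → Set) → Fin k → Fin k → Set
  Reach P = Star (Step P)

  Reach-map : ∀ {P Q : Fin m → Set} → (∀ {e} → P e → Q e) → ∀ {u v} → Reach P u v → Reach Q u v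
  Reach-map P⇒Q = Star.map λ (e , p , rest) → e , P⇒Q p , rest

  arc : ∀ {P : Fin m → Set} e → P e → Reach P (src e) (tgt e)
  arc e p = (e , p , refl , refl) ◅ ε

  Strong : Set
  Strong = ∀ u v → Reach (λ _ → ⊤) u v

  -- A walk in `Reach (_≢ e)` is a detour around `e`. The chosen loops are exempt: they stand for
  -- matching edges, without which the digraph itself would no longer be defined.
  Essential : (Fin k → Fin m) → Set
  Essential loop = ∀ e → (∀ i → e ≢ loop i) → ¬ Reach (_≢ e) (src e) (tgt e)

  Within : (Fin k → Set) → Fin m → Set
  Within R e = R (src e) × R (tgt e)

  -- The walk before the exit is recorded as staying inside `R`: with `R` the complement of a
  -- 2-cycle it becomes the middle of an ear.
  firstExit : ∀ {R : Fin k → Set} {Q : Fin m → Set} → Decidable R →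
              ∀ {u v} → Reach Q u v → R u → ¬ R v →
              ∃[ e ] Reach (Within R) u (src e) × R (src e) × ¬ R (tgt e)
  firstExit R? ε Ru ¬Rv = contradiction Ru ¬Rv
  firstExit R? ((e , _ , refl , refl) ◅ w) Ru ¬Rv with R? (tgt e)
  ... | no ¬Rt = e , ε , Ru , ¬Rt
  ... | yes Rt = let f , w′ , exit = firstExit R? w Rt ¬Rv in f , arc e (Ru , Rt) ◅◅ w′ , exit

  spanningForest : Strong → (S : List (Fin k)) → Unique S → ∀ {r} → r ∈ S →
    ∃[ K ] length K + length S ≤ k × (∀ v → ∃[ s ] s ∈ S × Reach (_∈ K) s v)
  spanningForest strong S uS {r} r∈S =
    grow k S [] (ℕ.m≤m+n k _) uS refl r∈S (λ v∈S → _ , v∈S , ε)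
    where
    Spans : List (Fin m) → Fin k → Set
    Spans K v = ∃[ s ] s ∈ S × Reach (_∈ K) s v

    -- `fuel` bounds the number of vertices still outside `R`. Each arc added to `K` adds exactly
    -- one vertex to `R`, which started as `S`; hence the equation of lengths.
    grow : ∀ fuel R K → k ≤ fuel + length R → Unique R → length K + length S ≡ length R →
           r ∈ R → (∀ {v} → v ∈ R → Spans K v) →
           ∃[ K′ ] length K′ + length S ≤ k × (∀ v → Spans K′ v)
    grow fuel R K enough uR size r∈R spans with all? (λ v → v ∈? R)
    ... | yes full = K , subst (_≤ k) (sym size) (Unique-Fin uR) , λ v → spans (full v)
    ... | no ¬full with ¬∀⟶∃¬ k (_∈ R) (_∈? R) ¬full
    ... | v , v∉R with firstExit (_∈? R) (strong r v) r∈R v∉R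
    ... | e , _ , e∈ , e∉ = continue fuel enough
      where
      uR′ : Unique (tgt e ∷ R)
      uR′ = ¬Any⇒All¬ R e∉ ∷ uR

      spans′ : ∀ {w} → w ∈ tgt e ∷ R → Spans (e ∷ K) w
      spans′ (here refl) = let s , s∈S , w = spans e∈ in
        s , s∈S , Reach-map there w ◅◅ arc e (here refl)
      spans′ (there w∈R) = let s , s∈S , w = spans w∈R in s , s∈S , Reach-map there w

      continue : ∀ fuel → k ≤ fuel + length R →
                 ∃[ K′ ] length K′ + length S ≤ k × (∀ v → Spans K′ v)
      -- Without fuel `R` already has `k` vertices, and `tgt e` would be one more.
      continue zero       k≤ = contradiction (ℕ.≤-trans (Unique-Fin uR′) k≤) ℕ.1+n≰n
      continue (suc fuel) k≤ = grow fuel (tgt e ∷ R) (e ∷ K)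
        (subst (k ≤_) (sym (ℕ.+-suc fuel _)) k≤) uR′ (cong suc size) (there r∈R) spans′

  -- Unlike in `Reach`, the vertices are pairwise distinct, and both lists appear in the type, so
  -- that the cycle closed by one further arc can be counted.
  data Path (P : Fin m → Set) : Fin k → Fin k → List (Fin k) → List (Fin m) → Set where
    stop : ∀ {v} → Path P v v (v ∷ []) []
    step : ∀ {u v w vs es} → (s : Step P u w) → Path P w v vs es → u ∉ vs →
           Path P u v (u ∷ vs) (proj₁ s ∷ es)

  module _ {P : Fin m → Set} where

    Path-unique : ∀ {u v vs es} → Path P u v vs es → Unique vs
    Path-unique stop             = [] ∷ []
    Path-unique (step _ p u∉) = ¬Any⇒All¬ _ u∉ ∷ Path-unique p

    Path-start : ∀ {u v vs es} → Path P u v vs es → u ∈ vs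
    Path-start stop           = here refl
    Path-start (step _ _ _) = here refl

    Path-end : ∀ {u v vs es} → Path P u v vs es → v ∈ vs
    Path-end stop           = here refl
    Path-end (step _ p _) = there (Path-end p)

    Path-length : ∀ {u v vs es} → Path P u v vs es → length vs ≡ suc (length es)
    Path-length stop           = refl
    Path-length (step _ p _) = cong suc (Path-length p)

    suffix : ∀ {u v w vs es} → Path P u v vs es → w ∈ vs → ∃[ vs′ ] ∃[ es′ ] Path P w v vs′ es′
    suffix stop               (here refl) = _ , _ , stop
    suffix p@(step _ _ _)   (here refl) = _ , _ , p
    suffix (step _ p _)     (there w∈)  = suffix p w∈

    Reach⇒Path : ∀ {u v} → Reach P u v → ∃[ vs ] ∃[ es ] Path P u v vs es
    Reach⇒Path ε = _ , _ , stop
    Reach⇒Path {u} (s ◅ w) with Reach⇒Path w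
    ... | vs , es , p with u ∈? vs
    ...   | yes u∈ = suffix p u∈
    ...   | no  u∉ = _ , _ , step s p u∉

    Path-from-start : ∀ {u v w vs es} → Path P u v vs es → w ∈ vs → Reach (_∈ es) u w
    Path-from-start stop           (here refl) = ε
    Path-from-start (step _ _ _) (here refl) = ε
    Path-from-start (step (e , _ , eqs) p _) (there w∈) =
      (e , here refl , eqs) ◅ Reach-map there (Path-from-start p w∈)

    Path-to-end : ∀ {u v w vs es} → Path P u v vs es → w ∈ vs → Reach (_∈ es) w v
    Path-to-end stop             (here refl) = ε
    Path-to-end p@(step _ _ _) (here refl) = Path-from-start p (Path-end p)
    Path-to-end (step _ p _)   (there w∈)  = Reach-map there (Path-to-end p w∈)

module _ {k m : ℕ} (src tgt : Fin m → Fin k) where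
  private
    module D = Digraph src tgt
    module Dᵒᵖ = Digraph tgt src

  reverse : ∀ {P u v} → Dᵒᵖ.Reach P u v → D.Reach P v u
  reverse = Star.reverse λ (e , p , t , s) → e , p , s , t

  -- Contract S: an out-forest and an in-forest rooted at S leave k ∸ |S| arcs
  -- each, and by minimality every arc is a loop, in F, or in one of them.
  size-bound : D.Strong → (loop : Fin k → Fin m) → D.Essential loop →
    ∀ S F r → Unique S → r ∈ S →
    (∀ {s} → s ∈ S → D.Reach (_∈ F) r s) → (∀ {s} → s ∈ S → D.Reach (_∈ F) s r) →
    m + 2 * length S ≤ length F + 3 * k
  size-bound strong loop essential S F r uS r∈S out into
    with D.spanningForest strong S uS r∈S
       | Dᵒᵖ.spanningForest (λ u v → Star.reverse (λ (e , p , s , t) → e , p , t , s) (strong v u)) S uS r∈S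
  ... | K , |K| , fromS | L , |L| , toS = begin
    m + 2 * length S                                ≡⟨ cong (_+ _) (sym (length-allFin m)) ⟩
    length (allFin m) + 2 * length S                ≤⟨ ℕ.+-monoˡ-≤ _ (Unique⇒length≤ (allFin⁺ m) (λ _ → all-kept _)) ⟩
    length kept + 2 * length S                      ≡⟨ cong (_+ _) |kept| ⟩
    length F + (length K + (length L + k)) + 2 * length S
      ≡⟨ solve 5 (λ f a b c s → f :+ (a :+ (b :+ c)) :+ con 2 :* s
                             := f :+ ((a :+ s) :+ ((b :+ s) :+ c)))
               refl (length F) (length K) (length L) k (length S) ⟩
    length F + ((length K + length S) + ((length L + length S) + k))
      ≤⟨ ℕ.+-monoʳ-≤ (length F) (ℕ.+-mono-≤ |K| (ℕ.+-monoˡ-≤ k |L|)) ⟩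
    length F + (k + (k + k))
      ≡⟨ solve 2 (λ f c → f :+ (c :+ (c :+ c)) := f :+ con 3 :* c) refl (length F) k ⟩
    length F + 3 * k                                ∎
    where
    open ℕ.≤-Reasoning
    open +-*-Solver

    kept : List (Fin m)
    kept = F ++ K ++ L ++ map loop (allFin k)

    |kept| : length kept ≡ length F + (length K + (length L + k))
    |kept| = trans (length-++ F) (cong (length F +_) (trans (length-++ K) (cong (length K +_)
             (trans (length-++ L) (cong (length L +_) (trans (length-map loop (allFin k)) (length-allFin k)))))))

    all-kept : ∀ e → e ∈ kept
    all-kept e with e ∈? kept
    ... | yes e∈ = e∈
    ... | no  e∉ = contradiction detour
      (essential e λ i e≡ → e∉ (∈-++⁺ʳ F (∈-++⁺ʳ K (∈-++⁺ʳ L (subst (_∈ _) (sym e≡) (∈-map⁺ loop (∈-allFin i)))))))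
      where
      avoid : ∀ {xs} → xs ⊆ kept → ∀ {f} → f ∈ xs → f ≢ e
      avoid ⊆kept f∈ refl = e∉ (⊆kept f∈)

      avoidF : ∀ {f} → f ∈ F → f ≢ e
      avoidF = avoid ∈-++⁺ˡ

      -- From `src e` along the in-forest to `S`, through `r` inside `F`, and along the out-forest
      -- to `tgt e`: only kept arcs are used, so `e` is avoided.
      detour : D.Reach (_≢ e) (src e) (tgt e)
      detour =
        let s , s∈S , fromsrc = toS (src e)
            t , t∈S , totgt   = fromS (tgt e)
        in D.Reach-map (avoid (∈-++⁺ʳ F ∘ ∈-++⁺ʳ K ∘ ∈-++⁺ˡ)) (reverse fromsrc)
           ◅◅ D.Reach-map avoidF (into s∈S) ◅◅ D.Reach-map avoidF (out t∈S)
           ◅◅ D.Reach-map (avoid (∈-++⁺ʳ F ∘ ∈-++⁺ˡ)) totgt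

-- Bouquets of triangles

-- The triangles are e₁ → e₀ → v → e₁, one for each remaining vertex v, all sharing the arc `back`.
-- The vertex `x` guarantees that there is at least one, which in the end gives a star with at least
-- two leaves.
record Bouquet {k m : ℕ} (src tgt : Fin m → Fin k) : Set where
  Arc : Fin k → Fin k → Set
  Arc u v = ∃[ e ] src e ≡ u × tgt e ≡ v

  field
    e₀ e₁ x    : Fin k
    e₀≢e₁      : e₀ ≢ e₁
    x≢e₀       : x ≢ e₀
    x≢e₁       : x ≢ e₁
    back       : Arc e₁ e₀
    from-e₀    : ∀ v → v ≢ e₀ → v ≢ e₁ → Arc e₀ v
    to-e₁      : ∀ v → v ≢ e₀ → v ≢ e₁ → Arc v e₁
    classify   : ∀ e → src e ≢ tgt e →
                 (src e ≡ e₁ × tgt e ≡ e₀)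
                 ⊎ (src e ≡ e₀ × tgt e ≢ e₀ × tgt e ≢ e₁)
                 ⊎ (tgt e ≡ e₁ × src e ≢ e₀ × src e ≢ e₁)
    simple     : ∀ e f → src e ≡ src f → tgt e ≡ tgt f → e ≡ f

module Extremal {k m : ℕ} (src tgt : Fin m → Fin k) (loop : Fin k → Fin m)
  (src-loop : ∀ i → src (loop i) ≡ i) (tgt-loop : ∀ i → tgt (loop i) ≡ i)
  (strong : Digraph.Strong src tgt) (essential : Digraph.Essential src tgt loop)
  (size : m + 3 ≡ 3 * k) (2≤k : 2 ≤ k)
  (acyclic₂ : ∀ e f → src e ≢ tgt e → src f ≡ tgt e → tgt f ≢ src e)
  where
  open Digraph src tgt

  infix 4 _⟶_
  _⟶_ : Fin k → Fin k → Set
  u ⟶ v = ∃[ e ] src e ≡ u × tgt e ≡ v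

  ⟶-asym : ∀ {u v} → u ≢ v → u ⟶ v → ¬ (v ⟶ u)
  ⟶-asym u≢v (e , refl , refl) (f , sf , tf) = acyclic₂ e f u≢v sf tf

  -- Subtracting `m + 3 = 3 * k` from `size-bound` eliminates `k`, so each strongly connected part
  -- is constrained by itself, wherever it sits in the digraph.
  strong-density : ∀ S F r → Unique S → r ∈ S →
    (∀ {s} → s ∈ S → Reach (_∈ F) r s) → (∀ {s} → s ∈ S → Reach (_∈ F) s r) →
    2 * length S ≤ length F + 3
  strong-density S F r uS r∈S out into = ℕ.+-cancelˡ-≤ m _ _ (begin
    m + 2 * length S   ≤⟨ size-bound src tgt strong loop essential S F r uS r∈S out into ⟩
    length F + 3 * k   ≡⟨ cong (length F +_) size ⟨
    length F + (m + 3) ≡⟨ solve 2 (λ f n → f :+ (n :+ con 3) := n :+ (f :+ con 3)) refl (length F) m ⟩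
    m + (length F + 3) ∎)
    where
    open ℕ.≤-Reasoning
    open +-*-Solver

  -- A second loop at a vertex, that is an edge parallel to a matching edge, would be bypassed by
  -- the empty walk.
  loopy : ∀ e → src e ≡ tgt e → e ≡ loop (src e)
  loopy e eq with any? (λ i → e ≟ loop i)
  ... | yes (i , refl) = cong loop (sym (src-loop i))
  ... | no none = contradiction
        (subst (Reach (_≢ e) (src e)) eq ε) (essential e (λ i e≡ → none (i , e≡)))

  -- Of two parallel arcs that are not loops, one is a detour around the other.
  parallel-free : ∀ e f → src e ≡ src f → tgt e ≡ tgt f → e ≡ f
  parallel-free e f s t with src e ≟ tgt e | e ≟ f
  ... | _ | yes e≡f = e≡f
  ... | yes l | no _ = trans (loopy e l) (trans (cong loop s) (sym (loopy f (trans (sym s) (trans l t)))))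
  ... | no ¬l | no e≢f = contradiction ((f , (e≢f ∘ sym) , sym s , sym t) ◅ ε)
    (essential e λ i e≡ → ¬l (trans (cong src e≡) (trans (src-loop i) (trans (sym (tgt-loop i)) (cong tgt (sym e≡))))))

  record Triangle (u v w : Fin k) : Set where
    constructor triangle
    field
      uv  : u ⟶ v
      vw  : v ⟶ w
      wu  : w ⟶ u
      u≢v : u ≢ v
      v≢w : v ≢ w
      w≢u : w ≢ u

  rotate : ∀ {u v w} → Triangle u v w → Triangle v w u
  rotate (triangle a b c p q r) = triangle b c a q r p

  -- A cycle on l vertices is a strong part with l arcs, so density gives l ≤ 3.
  arc-on-triangle : ∀ {u v} → u ⟶ v → u ≢ v → ∃[ w ] Triangle u v w
  arc-on-triangle (e , refl , refl) u≢v with Reach⇒Path (strong (tgt e) (src e))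
  ... | vs , es , p = close p refl refl
    where
    close : ∀ {a b vs es} → Path (λ _ → ⊤) a b vs es → a ≡ tgt e → b ≡ src e →
            ∃[ w ] Triangle (src e) (tgt e) w
    close stop a≡ b≡ = contradiction (trans (sym b≡) a≡) u≢v
    close (step (f , _ , s , t) stop _) a≡ b≡ =
      contradiction (trans t b≡) (acyclic₂ e f u≢v (trans s a≡))
    close (step (f , _ , s , t) (step {w} (g , _ , s′ , t′) stop w∉) a∉) a≡ b≡ =
      w , triangle (e , refl , refl) (f , trans s a≡ , t) (g , s′ , trans t′ b≡) u≢v
        (λ eq → a∉ (here (trans a≡ eq))) (λ eq → w∉ (here (trans eq (sym b≡))))
    close {vs = vs} {es} p@(step _ (step _ (step _ p₃ _) _) _) refl refl =
      contradiction (strong-density vs (e ∷ es) (tgt e) (Path-unique p) (Path-start p)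
        (λ s∈ → Reach-map there (Path-from-start p s∈))
        (λ s∈ → Reach-map there (Path-to-end p s∈) ◅◅ arc e (here refl)))
        (long (Path-length p₃))
      where
      -- Here `n` counts the arcs of the return path after its first three. Together with `e` the
      -- cycle has 4 + n vertices and 4 + n arcs, and 8 + 2n exceeds 7 + n.
      long : ∀ {n l} → l ≡ suc n → ¬ (2 * (3 + l) ≤ (4 + n) + 3)
      long {n} refl le = ℕ.<⇒≱ (ℕ.m≤n+m (8 + n) n) (subst₂ _≤_ eq (solve 1 (λ n → con 4 :+ n :+ con 3 := con 7 :+ n) refl n) le)
        where
        open +-*-Solver
        eq : 2 * (4 + n) ≡ n + (8 + n)
        eq = solve 1 (λ n → con 2 :* (con 4 :+ n) := n :+ (con 8 :+ n)) refl n

  -- If neither the arcs out of `s` nor the arcs into `s` agree, the crossed coincidences `a ≡ d`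
  -- and `b ≡ c` would create 2-cycles. The triangles then meet in `s` only: five vertices and six
  -- arcs, so density would give 10 ≤ 9.
  triangles-share-arc : ∀ {s a b c d} → Triangle s a b → Triangle s c d → a ≡ c ⊎ b ≡ d
  triangles-share-arc {s} {a} {b} {c} {d} T@(triangle (e₁ , p₁) (e₂ , p₂) (e₃ , p₃) s≢a a≢b b≢s)
                      T′@(triangle (f₁ , q₁) (f₂ , q₂) (f₃ , q₃) s≢c c≢d d≢s)
    with a ≟ c | b ≟ d
  ... | yes eq | _ = inj₁ eq
  ... | no _ | yes eq = inj₂ eq
  ... | no a≢c | no b≢d = contradiction
      (strong-density (s ∷ a ∷ b ∷ c ∷ d ∷ []) F s unique (here refl) out into) (ℕ.<⇒≱ ℕ.≤-refl)
    where
    F : List (Fin m)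
    F = e₁ ∷ e₂ ∷ e₃ ∷ f₁ ∷ f₂ ∷ f₃ ∷ []

    a≢d : a ≢ d
    a≢d refl = ⟶-asym s≢a (Triangle.uv T) (Triangle.wu T′)

    b≢c : b ≢ c
    b≢c refl = ⟶-asym s≢c (Triangle.uv T′) (Triangle.wu T)

    unique : Unique (s ∷ a ∷ b ∷ c ∷ d ∷ [])
    unique = (s≢a ∷ (b≢s ∘ sym) ∷ s≢c ∷ (d≢s ∘ sym) ∷ []) ∷ (a≢b ∷ a≢c ∷ a≢d ∷ [])
           ∷ (b≢c ∷ b≢d ∷ []) ∷ (c≢d ∷ []) ∷ [] ∷ []

    S₁ : Step (_∈ F) s a
    S₁ = e₁ , here refl , p₁
    S₂ : Step (_∈ F) a b
    S₂ = e₂ , there (here refl) , p₂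
    S₃ : Step (_∈ F) b s
    S₃ = e₃ , there (there (here refl)) , p₃
    R₁ : Step (_∈ F) s c
    R₁ = f₁ , there (there (there (here refl))) , q₁
    R₂ : Step (_∈ F) c d
    R₂ = f₂ , there (there (there (there (here refl)))) , q₂
    R₃ : Step (_∈ F) d s
    R₃ = f₃ , there (there (there (there (there (here refl))))) , q₃

    out : ∀ {v} → v ∈ s ∷ a ∷ b ∷ c ∷ d ∷ [] → Reach (_∈ F) s v
    out (here refl) = ε
    out (there (here refl)) = S₁ ◅ ε
    out (there (there (here refl))) = S₁ ◅ S₂ ◅ ε
    out (there (there (there (here refl)))) = R₁ ◅ ε
    out (there (there (there (there (here refl))))) = R₁ ◅ R₂ ◅ ε

    into : ∀ {v} → v ∈ s ∷ a ∷ b ∷ c ∷ d ∷ [] → Reach (_∈ F) v s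
    into (here refl) = ε
    into (there (here refl)) = S₂ ◅ S₃ ◅ ε
    into (there (there (here refl))) = S₃ ◅ ε
    into (there (there (there (here refl)))) = R₂ ◅ R₃ ◅ ε
    into (there (there (there (there (here refl))))) = R₃ ◅ ε

  some-triangle : ∃[ u ] ∃[ v ] ∃[ w ] Triangle u v w
  some-triangle = helper 2≤k strong
    where
    helper : 2 ≤ k → Strong → ∃[ u ] ∃[ v ] ∃[ w ] Triangle u v w
    helper (s≤s (s≤s _)) strong
      with firstExit (_≟ zero) (strong zero (suc zero)) refl (λ ())
    ... | e , _ , s≡ , t≢ = _ , _ , arc-on-triangle (e , refl , refl) (λ eq → t≢ (trans (sym eq) s≡))

  -- With three vertices no arc is distinguished; `u ⟶ v` plays the shared arc and `w` the only
  -- further vertex. The three reversed arcs are excluded by `⟶-asym`.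
  one-triangle : ∀ {u v w} → Triangle u v w → (∀ x → x ∈ u ∷ v ∷ w ∷ []) → Bouquet src tgt
  one-triangle {u} {v} {w} T@(triangle uv vw wu u≢v v≢w w≢u) all = record
    { e₀ = v ; e₁ = u ; x = w
    ; e₀≢e₁ = u≢v ∘ sym ; x≢e₀ = v≢w ∘ sym ; x≢e₁ = w≢u
    ; back = uv
    ; from-e₀ = λ y y≢v y≢u → subst (v ⟶_) (sym (third y y≢v y≢u)) vw
    ; to-e₁ = λ y y≢v y≢u → subst (_⟶ u) (sym (third y y≢v y≢u)) wu
    ; classify = λ e → classify e (all (src e)) (all (tgt e))
    ; simple = parallel-free
    }
    where
    third : ∀ y → y ≢ v → y ≢ u → y ≡ w
    third y y≢v y≢u with all y
    ... | here eq = contradiction eq y≢u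
    ... | there (here eq) = contradiction eq y≢v
    ... | there (there (here eq)) = eq

    classify : ∀ e → src e ∈ u ∷ v ∷ w ∷ [] → tgt e ∈ u ∷ v ∷ w ∷ [] → src e ≢ tgt e →
      (src e ≡ u × tgt e ≡ v) ⊎ (src e ≡ v × tgt e ≢ v × tgt e ≢ u) ⊎ (tgt e ≡ u × src e ≢ v × src e ≢ u)
    classify e (here s) (here t) s≢t = contradiction (trans s (sym t)) s≢t
    classify e (here s) (there (here t)) s≢t = inj₁ (s , t)
    classify e (here s) (there (there (here t))) s≢t = contradiction (e , s , t) (⟶-asym w≢u wu)
    classify e (there (here s)) (here t) s≢t = contradiction (e , s , t) (⟶-asym u≢v uv)
    classify e (there (here s)) (there (here t)) s≢t = contradiction (trans s (sym t)) s≢t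
    classify e (there (here s)) (there (there (here t))) s≢t =
      inj₂ (inj₁ (s , (λ eq → v≢w (trans (sym eq) t)) , λ eq → w≢u (trans (sym t) eq)))
    classify e (there (there (here s))) (here t) s≢t =
      inj₂ (inj₂ (t , (λ eq → v≢w (trans (sym eq) s)) , λ eq → w≢u (trans (sym s) eq)))
    classify e (there (there (here s))) (there (here t)) s≢t = contradiction (e , s , t) (⟶-asym v≢w vw)
    classify e (there (there (here s))) (there (there (here t))) s≢t = contradiction (trans s (sym t)) s≢t

  module TwoTriangles {e₀ e₁ x y : Fin k} (x≢y : x ≢ y)
                      (T : Triangle e₀ x e₁) (T′ : Triangle e₀ y e₁) where
    open Triangle T renaming (wu to back; w≢u to e₁≢e₀; u≢v to e₀≢x; v≢w to x≢e₁)

    -- A triangle compared with both `T` and `T′` cannot follow each of them at the tip, where they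
    -- differ, so it must share the other vertex. This is why two triangles are needed to single out
    -- the common arc.
    agree : ∀ {v w s : Fin k} → v ≡ x ⊎ w ≡ s → v ≡ y ⊎ w ≡ s → w ≡ s
    agree (inj₂ eq) _         = eq
    agree (inj₁ _)  (inj₂ eq) = eq
    agree (inj₁ p)  (inj₁ q)  = contradiction (trans (sym p) q) x≢y

    Spoke : Fin k → Set
    Spoke v = v ≢ e₀ → v ≢ e₁ → e₀ ⟶ v × v ⟶ e₁

    from-e₀ : ∀ {v w} → Triangle e₀ v w → w ≡ e₁
    from-e₀ A = agree (triangles-share-arc A T) (triangles-share-arc A T′)

    from-e₁ : ∀ {v w} → Triangle e₁ v w → v ≡ e₀
    from-e₁ A = agree (swap (triangles-share-arc A (rotate (rotate T))))
                      (swap (triangles-share-arc A (rotate (rotate T′))))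
    -- Compared with the known triangle u → e₁ → e₀ → u, the triangle `A` either continues to `e₁`
    -- at once or returns through `e₀`; in the latter case, read from `e₀`, it is subject to
    -- `from-e₀`.
    from-spoke : ∀ {u v w} → e₀ ⟶ u → u ⟶ e₁ → u ≢ e₀ → u ≢ e₁ → Triangle u v w → v ≡ e₁
    from-spoke e₀u ue₁ u≢e₀ u≢e₁ A
      with triangles-share-arc A (triangle ue₁ back e₀u u≢e₁ e₁≢e₀ (u≢e₀ ∘ sym))
    ... | inj₁ v≡e₁ = v≡e₁
    ... | inj₂ refl = from-e₀ (rotate (rotate A))

    classify-arc : ∀ {u v} → u ⟶ v → u ≢ v → Spoke u →
      (u ≡ e₁ × v ≡ e₀) ⊎ (u ≡ e₀ × v ≢ e₀ × v ≢ e₁) ⊎ (v ≡ e₁ × u ≢ e₀ × u ≢ e₁)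
    classify-arc {u} {v} uv u≢v spoke with arc-on-triangle uv u≢v | u ≟ e₀ | u ≟ e₁
    ... | w , A | yes refl | _ = inj₂ (inj₁ (refl , u≢v ∘ sym , λ v≡e₁ →
            ⟶-asym e₁≢e₀ back (subst (u ⟶_) v≡e₁ uv)))
    ... | w , A | no _ | yes refl = inj₁ (refl , from-e₁ A)
    ... | w , A | no u≢e₀ | no u≢e₁ = let e₀u , ue₁ = spoke u≢e₀ u≢e₁ in
            inj₂ (inj₂ (from-spoke e₀u ue₁ u≢e₀ u≢e₁ A , u≢e₀ , u≢e₁))

    spoke-step : ∀ {u v} → u ⟶ v → Spoke u → Spoke v
    spoke-step {u} {v} uv spoke v≢e₀ v≢e₁ with u ≟ v
    ... | yes refl = spoke v≢e₀ v≢e₁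
    ... | no u≢v with classify-arc uv u≢v spoke
    ...   | inj₁ (_ , v≡e₀) = contradiction v≡e₀ v≢e₀
    ...   | inj₂ (inj₂ (v≡e₁ , _)) = contradiction v≡e₁ v≢e₁
    ...   | inj₂ (inj₁ (refl , _)) with arc-on-triangle uv u≢v
    ...     | w , A = uv , subst (v ⟶_) (from-e₀ A) (Triangle.vw A)

    -- `Spoke` is vacuous at `e₀` and passes along every arc by `spoke-step`, so strong connectivity
    -- spreads it to all vertices.
    spokes : ∀ v → Spoke v
    spokes v = Star.gfold id (λ a b → Spoke a → Spoke b)
      (λ (e , _ , s , t) rest → rest ∘ spoke-step (e , s , t)) id (strong e₀ v)
      (λ e₀≢e₀ _ → contradiction refl e₀≢e₀)

    bouquet : Bouquet src tgt
    bouquet = record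
      { e₀ = e₀ ; e₁ = e₁ ; x = x
      ; e₀≢e₁ = e₁≢e₀ ∘ sym ; x≢e₀ = e₀≢x ∘ sym ; x≢e₁ = x≢e₁
      ; back = back
      ; from-e₀ = λ v p q → proj₁ (spokes v p q)
      ; to-e₁ = λ v p q → proj₂ (spokes v p q)
      ; classify = λ e s≢t → classify-arc (e , refl , refl) s≢t (spokes (src e))
      ; simple = parallel-free
      }

  -- Either one triangle covers all vertices, or an arc `e` leaves it. The triangle `A` through `e`
  -- meets the old one in `src e` but ends `e` elsewhere, so the two share the arc into `src e`, and
  -- `TwoTriangles` applies.
  bouquet : Bouquet src tgt
  bouquet with some-triangle
  ... | a , b , c , T with any? (λ v → ¬? (v ∈? (a ∷ b ∷ c ∷ [])))
  ... | no none = one-triangle T λ v → decidable-stable (v ∈? _) (λ v∉ → none (v , v∉))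
  ... | yes (v , v∉) with firstExit (_∈? (a ∷ b ∷ c ∷ [])) (strong a v) (here refl) v∉
  ... | e , _ , s∈ , t∉ with arc-on-triangle (e , refl , refl) (λ eq → t∉ (subst (_∈ _) eq s∈))
  ... | w , A = split s∈
    where
    extend : ∀ {b′ c′} → Triangle (src e) b′ c′ → tgt e ≢ b′ → Bouquet src tgt
    extend B t≢ with triangles-share-arc A B
    ... | inj₁ eq = contradiction eq t≢
    ... | inj₂ refl = TwoTriangles.bouquet (t≢ ∘ sym) B A

    split : src e ∈ a ∷ b ∷ c ∷ [] → Bouquet src tgt
    split (here refl) = extend T λ eq → t∉ (there (here eq))
    split (there (here refl)) = extend (rotate T) λ eq → t∉ (there (there (here eq)))
    split (there (there (here refl))) = extend (rotate (rotate T)) λ eq → t∉ (here eq)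

-- Bipartite graphs with a perfect matching

module _ {n} {P : Fin n → Set} (P? : Decidable P) where

  subset : Subset n
  subset = tabulate (does ∘ P?)

  ∈-subset⁺ : ∀ {i} → P i → i ∈ₛ subset
  ∈-subset⁺ {i} p = lookup⇒[]= i subset (trans (lookup∘tabulate _ i) (dec-true (P? i) p))

  ∈-subset⁻ : ∀ {i} → i ∈ₛ subset → P i
  ∈-subset⁻ {i} i∈ with P? i | trans (sym (lookup∘tabulate (does ∘ P?) i)) ([]=⇒lookup i∈)
  ... | yes p | _ = p

bijective⇒↔ : {A B : Set} (f : A → B) → Injective _≡_ _≡_ f → (∀ y → ∃[ x ] f x ≡ y) → A ↔ B
bijective⇒↔ f inj surj = ⤖⇒↔ (mk⤖ {to = f} (inj , λ y → proj₁ (surj y) , λ { refl → proj₂ (surj y) }))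

to-injective : {A B : Set} (f : A ↔ B) → Injective _≡_ _≡_ (Inverse.to f)
to-injective f {x} {y} eq =
  trans (sym (Inverse.strictlyInverseʳ f x)) (trans (cong (Inverse.from f) eq) (Inverse.strictlyInverseʳ f y))

module _ (G : Graph) where
  open Graph G hiding (order; size)

  Joins-incidentˡ : ∀ {e u v} → Joins e u v → Incident e u
  Joins-incidentˡ (inj₁ eq) = inj₁ (cong proj₁ eq)
  Joins-incidentˡ (inj₂ eq) = inj₂ (cong proj₂ eq)

  Joins-sym : ∀ {e u v} → Joins e u v → Joins e v u
  Joins-sym = swap

  Joins-incidentʳ : ∀ {e u v} → Joins e u v → Incident e v
  Joins-incidentʳ j = Joins-incidentˡ (Joins-sym j)

  Incident-ends : ∀ {e u v w} → Joins e u v → Incident e w → w ≡ u ⊎ w ≡ v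
  Incident-ends (inj₁ eq) (inj₁ refl) = inj₁ (cong proj₁ eq)
  Incident-ends (inj₁ eq) (inj₂ refl) = inj₂ (cong proj₂ eq)
  Incident-ends (inj₂ eq) (inj₁ refl) = inj₂ (cong proj₁ eq)
  Incident-ends (inj₂ eq) (inj₂ refl) = inj₁ (cong proj₂ eq)

  Walk-sym : ∀ {u v} → Walk u v → Walk v u
  Walk-sym = Star.reverse λ (e , j) → e , Joins-sym j

-- A bipartite graph together with a perfect matching: the i-th white vertex
-- `vertex (true , i)` is matched by `loop i` to the i-th black vertex.
-- Contracting the matching turns every edge e into an arc from src e to tgt e.
record Framing (G : Graph) : Set where
  open Graph G hiding (order; size)
  field
    k        : ℕ
    vertex   : (Bool × Fin k) ↔ V
    src tgt  : E → Fin k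
    joins    : ∀ e → Joins e (Inverse.to vertex (true , src e)) (Inverse.to vertex (false , tgt e))
    loop     : Fin k → E
    src-loop : ∀ i → src (loop i) ≡ i
    tgt-loop : ∀ i → tgt (loop i) ≡ i

  open Inverse vertex public using () renaming (to to at; from to name)
  open Digraph src tgt public

  at-name : ∀ v → at (name v) ≡ v
  at-name = Inverse.strictlyInverseˡ vertex

  white-black : ∀ {i j} → at (true , i) ≢ at (false , j)
  white-black eq with () ← to-injective vertex eq

  src-incident : ∀ e → Incident e (at (true , src e))
  src-incident e = Joins-incidentˡ G (joins e)

  tgt-incident : ∀ e → Incident e (at (false , tgt e))
  tgt-incident e = Joins-incidentʳ G (joins e)

  incident-src : ∀ {e i} → Incident e (at (true , i)) → src e ≡ i
  incident-src {e} inc with Incident-ends G (joins e) inc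
  ... | inj₁ eq = sym (cong proj₂ (to-injective vertex eq))
  ... | inj₂ eq = contradiction eq white-black

  incident-tgt : ∀ {e j} → Incident e (at (false , j)) → tgt e ≡ j
  incident-tgt {e} inc with Incident-ends G (joins e) inc
  ... | inj₁ eq = contradiction (sym eq) white-black
  ... | inj₂ eq = sym (cong proj₂ (to-injective vertex eq))

  order≡ : order G ≡ 2 * k
  order≡ = ↔⇒≡ (↔-trans (↔-sym vertex) (↔-trans (↔-sym 2↔Bool ×-↔ ↔-refl) (↔-sym *↔×)))

-- Strong connectivity and matching coveredness

module _ {G : Graph} (F : Framing G) where
  open Graph G hiding (order; size)
  open Framing F

  -- Both colour classes have `k` vertices, so choosing edges at the white vertices with distinct
  -- black ends reaches every black vertex.
  matching⇒PerfectMatching : (ν : Fin k → E) → (∀ i → src (ν i) ≡ i) → Injective _≡_ _≡_ (tgt ∘ ν) →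
    PerfectMatching G (subset (λ e → ν (src e) ≟ e))
  matching⇒PerfectMatching ν src-ν inj v = subst Matched (at-name v) (matched (name v))
    where
    chosen? : Decidable (λ e → ν (src e) ≡ e)
    chosen? e = ν (src e) ≟ e

    Matched : V → Set
    Matched v = ∃[ e ] (e ∈ₛ subset chosen? × Incident e v) ×
                (∀ {f} → f ∈ₛ subset chosen? × Incident f v → e ≡ f)

    chosen : ∀ i → ν i ∈ₛ subset chosen?
    chosen i = ∈-subset⁺ chosen? (cong ν (src-ν i))

    matched : ∀ x → Matched (at x)
    matched (true , i) = ν i , (chosen i , subst (λ j → Incident (ν i) (at (true , j))) (src-ν i) (src-incident (ν i))) ,
      λ (f∈ , inc) → trans (cong ν (sym (incident-src inc))) (∈-subset⁻ chosen? f∈)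
    matched (false , j) with injective⇒surjective (tgt ∘ ν) inj j
    ... | i , refl = ν i , (chosen i , tgt-incident (ν i)) , λ {f} (f∈ , inc) →
      let f≡ = ∈-subset⁻ chosen? f∈
      in trans (cong ν (inj (trans (sym (incident-tgt inc)) (cong tgt (sym f≡))))) f≡

  -- Alternate the matching along the path: ν uses the arc out of each vertex
  -- of the path before its end v, and the loop elsewhere.
  alternate : ∀ {P u v vs es} → Path P u v vs es →
    Σ[ ν ∈ (Fin k → E) ] (∀ i → src (ν i) ≡ i) × (∀ i → i ≢ v → tgt (ν i) ≢ u) ×
           (∀ i j → i ≢ v → j ≢ v → tgt (ν i) ≡ tgt (ν j) → i ≡ j) × (∀ i → i ∉ vs → ν i ≡ loop i)
  alternate stop = loop , src-loop , (λ i i≢v eq → i≢v (trans (sym (tgt-loop i)) eq)) ,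
    (λ i j _ _ eq → trans (sym (tgt-loop i)) (trans eq (tgt-loop j))) , λ _ _ → refl
  alternate {u = u} {v} (step {w = w} {vs} (e , _ , s , t) p u∉) with alternate p
  ... | ν , src-ν , misses , inj , off = ν′ , src-ν′ , misses′ , inj′ , off′
    where
    ν′ : Fin k → E
    ν′ i with i ≟ u
    ... | yes _ = e
    ... | no  _ = ν i

    w≢u : w ≢ u
    w≢u refl = u∉ (Path-start p)

    u≢v : u ≢ v
    u≢v refl = u∉ (Path-end p)

    tgt-νu : tgt (ν u) ≡ u
    tgt-νu = trans (cong tgt (off u u∉)) (tgt-loop u)

    src-ν′ : ∀ i → src (ν′ i) ≡ i
    src-ν′ i with i ≟ u
    ... | yes refl = s
    ... | no  _    = src-ν i

    misses′ : ∀ i → i ≢ v → tgt (ν′ i) ≢ u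
    misses′ i i≢v eq with i ≟ u
    ... | yes _  = w≢u (trans (sym t) eq)
    ... | no i≢u = i≢u (inj i u i≢v u≢v (trans eq (sym tgt-νu)))

    inj′ : ∀ i j → i ≢ v → j ≢ v → tgt (ν′ i) ≡ tgt (ν′ j) → i ≡ j
    inj′ i j i≢v j≢v eq with i ≟ u | j ≟ u
    ... | yes p | yes q = trans p (sym q)
    ... | yes _ | no _  = contradiction (trans (sym eq) t) (misses j j≢v)
    ... | no _  | yes _ = contradiction (trans eq t) (misses i i≢v)
    ... | no _  | no _  = inj i j i≢v j≢v eq

    off′ : ∀ i → i ∉ u ∷ vs → ν′ i ≡ loop i
    off′ i i∉ with i ≟ u
    ... | yes i≡u = contradiction (here i≡u) i∉
    ... | no _    = off i (i∉ ∘ there)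

  -- A path from `tgt e` back to `src e` closes with `e` to a directed cycle, which is an
  -- alternating cycle of the graph. `alternate` shifts the matching along the path and leaves white
  -- `src e` and black `tgt e` to be joined by `e`.
  strong⇒covered : Strong → ∀ e → ∃[ M ] PerfectMatching G M × e ∈ₛ M
  strong⇒covered strong e with Reach⇒Path (strong (tgt e) (src e))
  ... | vs , es , p with alternate p
  ... | ν , src-ν , misses , inj , _ =
    _ , matching⇒PerfectMatching μ src-μ (λ {i} {j} → inj-μ i j) , ∈-subset⁺ (λ f → μ (src f) ≟ f) μ-e
    where
    μ : Fin k → E
    μ i with i ≟ src e
    ... | yes _ = e
    ... | no  _ = ν i

    src-μ : ∀ i → src (μ i) ≡ i
    src-μ i with i ≟ src e
    ... | yes i≡ = sym i≡
    ... | no  _  = src-ν i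

    μ-e : μ (src e) ≡ e
    μ-e with src e ≟ src e
    ... | yes _ = refl
    ... | no ≢  = contradiction refl ≢

    inj-μ : ∀ i j → tgt (μ i) ≡ tgt (μ j) → i ≡ j
    inj-μ i j eq with i ≟ src e | j ≟ src e
    ... | yes p  | yes q  = trans p (sym q)
    ... | yes _  | no j≢  = contradiction (sym eq) (misses j j≢)
    ... | no i≢  | yes _  = contradiction eq (misses i i≢)
    ... | no i≢  | no j≢  = inj i j i≢ j≢ eq

  strong⇒connected : Strong → Connected G
  strong⇒connected strong u v = subst₂ Walk (at-name u) (at-name v)
    (toWhite (name u) ◅◅ whites _ _ ◅◅ Walk-sym G (toWhite (name v)))
    where
    rung : ∀ i → Walk (at (false , i)) (at (true , i))
    rung i = (loop i , Joins-sym G (subst₂ (λ a b → Joins (loop i) (at (true , a)) (at (false , b)))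
                                     (src-loop i) (tgt-loop i) (joins (loop i)))) ◅ ε

    toWhite : ∀ x → Walk (at x) (at (true , proj₂ x))
    toWhite (true  , i) = ε
    toWhite (false , i) = rung i

    whites : ∀ i j → Walk (at (true , i)) (at (true , j))
    whites i j = Star.kleisliStar (λ i → at (true , i))
      (λ { (e , _ , refl , refl) → (e , joins e) ◅ rung (tgt e) }) (strong i j)

  -- The arcs of a perfect matching through e permute the vertices; the orbit
  -- of src e leads from tgt e back to src e.
  covered⇒return : ∀ e → (∃[ M ] PerfectMatching G M × e ∈ₛ M) → Reach (λ _ → ⊤) (tgt e) (src e)
  covered⇒return e (M , perfect , e∈) = subst₂ (Reach _) (cong tgt (ν-unique e e∈ refl)) (proj₂ orbit) (path (proj₁ orbit))
    where
    ν : Fin k → E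
    ν i = proj₁ (perfect (at (true , i)))

    ν∈M : ∀ i → ν i ∈ₛ M
    ν∈M i = proj₁ (proj₁ (proj₂ (perfect (at (true , i)))))

    src-ν : ∀ i → src (ν i) ≡ i
    src-ν i = incident-src (proj₂ (proj₁ (proj₂ (perfect (at (true , i))))))

    ν-unique : ∀ {i} f → f ∈ₛ M → src f ≡ i → ν i ≡ f
    ν-unique f f∈ refl = proj₂ (proj₂ (perfect (at (true , src f)))) (f∈ , src-incident f)

    inj : Injective _≡_ _≡_ (tgt ∘ ν)
    inj {i} {j} eq = trans (sym (src-ν i)) (trans (cong src same) (src-ν j))
      where
      unique = proj₂ (proj₂ (perfect (at (false , tgt (ν j)))))
      same : ν i ≡ ν j
      same = trans (sym (unique (ν∈M i , subst (λ b → Incident (ν i) (at (false , b))) eq (tgt-incident (ν i)))))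
                   (unique (ν∈M j , tgt-incident (ν j)))

    orbit : ∃[ d ] iterate (tgt ∘ ν) (suc d) (src e) ≡ src e
    orbit = orbit-returns (tgt ∘ ν) inj (src e)

    path : ∀ d → Reach (λ _ → ⊤) (tgt (ν (src e))) (iterate (tgt ∘ ν) (suc d) (src e))
    path zero    = ε
    path (suc d) = path d ◅◅ (ν _ , tt , src-ν _ , refl) ◅ ε

  -- Walks of the graph project to labels. Matched vertices have the same label, an edge taken from
  -- white to black is an arc, and taken from black to white it is replaced by the walk from
  -- `covered⇒return`.
  covered⇒strong : MatchingCovered G → Strong
  covered⇒strong mc i j = subst₂ (Reach _) (label-at i) (label-at j)
    (Star.kleisliStar label adjacent (connected (at (true , i)) (at (true , j))))
    where
    open MatchingCovered mc
    label : V → Fin k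
    label v = proj₂ (name v)

    label-at : ∀ {b} i → label (at (b , i)) ≡ i
    label-at i = cong proj₂ (Inverse.strictlyInverseʳ vertex _)

    label-end : ∀ {e v} → Incident e v → label v ≡ src e ⊎ label v ≡ tgt e
    label-end {e} inc with Incident-ends G (joins e) inc
    ... | inj₁ refl = inj₁ (label-at _)
    ... | inj₂ refl = inj₂ (label-at _)

    between : ∀ e {a b} → a ≡ src e ⊎ a ≡ tgt e → b ≡ src e ⊎ b ≡ tgt e → Reach (λ _ → ⊤) a b
    between e (inj₁ refl) (inj₁ refl) = ε
    between e (inj₁ refl) (inj₂ refl) = arc e tt
    between e (inj₂ refl) (inj₁ refl) = covered⇒return e (covered e)
    between e (inj₂ refl) (inj₂ refl) = ε

    adjacent : ∀ {u v} → Adjacent u v → Reach (λ _ → ⊤) (label u) (label v)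
    adjacent (e , j) = between e (label-end (Joins-incidentˡ G j)) (label-end (Joins-incidentʳ G j))

-- Minimality and exchange of the matching

module _ {n : ℕ} (x y : Fin n) where

  swapped-left : swapped x y x ≡ y
  swapped-left with x ≟ x
  ... | yes _ = refl
  ... | no ≢  = contradiction refl ≢

  swapped-right : swapped x y y ≡ x
  swapped-right with y ≟ x
  ... | yes y≡x = y≡x
  ... | no _ with y ≟ y
  ...   | yes _ = refl
  ...   | no ≢  = contradiction refl ≢

  swapped-other : ∀ {z} → z ≢ x → z ≢ y → swapped x y z ≡ z
  swapped-other {z} z≢x z≢y with z ≟ x
  ... | yes z≡x = contradiction z≡x z≢x
  ... | no _ with z ≟ y
  ...   | yes z≡y = contradiction z≡y z≢y
  ...   | no _    = refl

-- Deleting an edge outside the fixed matching keeps that matching perfect, so the framing descends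
-- to `F⁻`. A detour around `e` would keep `F⁻` strong, hence the smaller graph matching covered.
minimal⇒essential : ∀ {G} (F : Framing G) → MinimalMatchingCovered G → Framing.Essential F (Framing.loop F)
minimal⇒essential {mkGraph n zero    ends loopless} F (mc , minimal) ()
minimal⇒essential {G@(mkGraph n (suc m) ends loopless)} F (mc , minimal) e notLoop detour =
  minimal e record
    { 4≤order   = MatchingCovered.4≤order mc
    ; connected = strong⇒connected F⁻ strong⁻
    ; covered   = strong⇒covered F⁻ strong⁻
    }
  where
  open Framing F

  F⁻ : Framing (deleteEdge G e)
  F⁻ = record
    { k        = k
    ; vertex   = vertex
    ; src      = src ∘ punchIn e
    ; tgt      = tgt ∘ punchIn e
    ; joins    = λ f → joins (punchIn e f)
    ; loop     = λ i → punchOut (notLoop i)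
    ; src-loop = λ i → trans (cong src (punchIn-punchOut (notLoop i))) (src-loop i)
    ; tgt-loop = λ i → trans (cong tgt (punchIn-punchOut (notLoop i))) (tgt-loop i)
    }

  keep : ∀ {u v} → Step (_≢ e) u v → Framing.Reach F⁻ (λ _ → ⊤) u v
  keep (f , f≢e , refl , refl) =
    (punchOut (f≢e ∘ sym) , tt , cong src (punchIn-punchOut _) , cong tgt (punchIn-punchOut _)) ◅ ε

  bypass : ∀ {u v} → Step (λ _ → ⊤) u v → Framing.Reach F⁻ (λ _ → ⊤) u v
  bypass (f , _ , refl , refl) with f ≟ e
  ... | yes refl = Star.kleisliStar id keep detour
  ... | no f≢e   = keep (f , f≢e , refl , refl)

  strong⁻ : Framing.Strong F⁻
  strong⁻ u v = Star.kleisliStar id bypass (covered⇒strong F mc u v)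

module _ {G : Graph} (F : Framing G) where
  open Framing F

  -- Exchange the matching along the 4-cycle formed by e, f and the loops at
  -- their ends.
  exchange : ∀ e f → src e ≢ tgt e → src f ≡ tgt e → tgt f ≡ src e → Framing G
  exchange e f x≢y sf tf = record
    { k        = k
    ; vertex   = ↔-trans (mk↔ₛ′ τ τ⁻ τ-τ⁻ τ⁻-τ) vertex
    ; src      = src
    ; tgt      = swapped y x ∘ tgt
    ; joins    = λ g → subst (λ j → Graph.Joins G g (at (true , src g)) (at (false , j)))
                         (sym (swapped-inverse x y)) (joins g)
    ; loop     = loop′
    ; src-loop = src-loop′
    ; tgt-loop = tgt-loop′
    }
    where
    x = src e
    y = tgt e

    τ τ⁻ : Bool × Fin k → Bool × Fin k
    τ (true  , i) = true , i
    τ (false , i) = false , swapped x y i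
    τ⁻ (true  , i) = true , i
    τ⁻ (false , i) = false , swapped y x i

    τ-τ⁻ : ∀ v → τ (τ⁻ v) ≡ v
    τ-τ⁻ (true  , i) = refl
    τ-τ⁻ (false , i) = cong (false ,_) (swapped-inverse x y)

    τ⁻-τ : ∀ v → τ⁻ (τ v) ≡ v
    τ⁻-τ (true  , i) = refl
    τ⁻-τ (false , i) = cong (false ,_) (swapped-inverse y x)

    loop′ : Fin k → Fin (size G)
    loop′ i with i ≟ x | i ≟ y
    ... | yes _ | _     = e
    ... | no _  | yes _ = f
    ... | no _  | no _  = loop i

    src-loop′ : ∀ i → src (loop′ i) ≡ i
    src-loop′ i with i ≟ x | i ≟ y
    ... | yes i≡x | _       = sym i≡x
    ... | no _    | yes i≡y = trans sf (sym i≡y)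
    ... | no _    | no _    = src-loop i

    tgt-loop′ : ∀ i → swapped y x (tgt (loop′ i)) ≡ i
    tgt-loop′ i with i ≟ x | i ≟ y
    ... | yes refl | _        = swapped-left y x
    ... | no _     | yes refl = trans (cong (swapped y x) tf) (swapped-right y x)
    ... | no i≢x   | no i≢y   = trans (cong (swapped y x) (tgt-loop i)) (swapped-other y x i≢y i≢x)

module _ {G : Graph} (F : Framing G) (minimal : MinimalMatchingCovered G) where
  open Framing F

  private
    strong : Strong
    strong = covered⇒strong F (proj₁ minimal)

  -- An ear of the 2-cycle x → y → x starts with g at x.  If it ends at y, it is
  -- a detour around e; if it ends at x, it becomes a detour around the loop
  -- at x once the matching is exchanged along the 2-cycle.
  no-ear : ∀ e f → src e ≢ tgt e → src f ≡ tgt e → tgt f ≡ src e →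
           ∀ g → src g ≡ src e → tgt g ∉ src e ∷ tgt e ∷ [] → ⊥
  no-ear e f x≢y sf tf g sg tg∉
    with firstExit (λ v → ¬? (v ∈? (src e ∷ tgt e ∷ []))) (strong (tgt g) (src e)) tg∉ (λ x∉ → x∉ (here refl))
  ... | h , ear , sh∉ , th∈ with decidable-stable (tgt h ∈? (src e ∷ tgt e ∷ [])) th∈
  ... | there (here th≡y) = minimal⇒essential F minimal e not-loop
        ((g , (λ { refl → tg∉ (there (here refl)) }) , sg , refl) ◅
         Reach-map (λ (s∉ , _) → avoid s∉) ear ◅◅ (h , avoid sh∉ , refl , th≡y) ◅ ε)
    where
    not-loop : ∀ i → e ≢ loop i
    not-loop i refl = x≢y (trans (src-loop i) (sym (tgt-loop i)))

    avoid : ∀ {a} → src a ∉ src e ∷ tgt e ∷ [] → a ≢ e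
    avoid s∉ refl = s∉ (here refl)
  ... | here th≡x = minimal⇒essential F′ minimal (loop x) not-loop
        (subst₂ (F′.Reach (_≢ loop x)) (sym (src-loop x))
           (sym (trans (cong (swapped y x) (tgt-loop x)) (swapped-right y x)))
        ((g , (λ { refl → tg∉ (here (tgt-loop x)) }) , sg , unmoved tg∉) ◅
         Star.map (λ (a , (s∉ , t∉) , s , t) → a , avoid s∉ , s , trans (unmoved t∉) t) ear ◅◅
         (h , avoid sh∉ , refl , trans (cong (swapped y x) th≡x) (swapped-right y x)) ◅ ε))
    where
    x = src e
    y = tgt e
    F′ = exchange F e f x≢y sf tf
    module F′ = Framing F′

    not-loop : ∀ i → loop x ≢ F′.loop i
    not-loop i eq = x≢y (sym (begin
      y                            ≡⟨ swapped-right y x ⟨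
      swapped y x x                ≡⟨ cong (swapped y x) (tgt-loop x) ⟨
      F′.tgt (loop x)              ≡⟨ cong F′.tgt eq ⟩
      F′.tgt (F′.loop i)           ≡⟨ F′.tgt-loop i ⟩
      i                            ≡⟨ F′.src-loop i ⟨
      src (F′.loop i)              ≡⟨ cong src eq ⟨
      src (loop x)                 ≡⟨ src-loop x ⟩
      x                            ∎))
      where open ≡-Reasoning

    avoid : ∀ {a} → src a ∉ x ∷ y ∷ [] → a ≢ loop x
    avoid s∉ refl = s∉ (here (src-loop x))

    unmoved : ∀ {v} → v ∉ x ∷ y ∷ [] → swapped y x v ≡ v
    unmoved v∉ = swapped-other y x (v∉ ∘ there ∘ here) (v∉ ∘ here)

-- From extremal graphs to bouquets

module _ {G : Graph} (F : Framing G) (extremal : EdgeExtremalMinimalBipartiteMatchingCovered G) where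
  open Framing F
  open EdgeExtremalMinimalBipartiteMatchingCovered extremal

  private
    strong : Strong
    strong = covered⇒strong F (proj₁ minimal)

  size≡ : size G + 3 ≡ 3 * k
  size≡ = ℕ.*-cancelˡ-≡ _ _ 2 (begin
    2 * (size G + 3)   ≡⟨ ℕ.*-distribˡ-+ 2 (size G) 3 ⟩
    2 * size G + 6     ≡⟨ edgeExtremal ⟩
    3 * order G        ≡⟨ cong (3 *_) order≡ ⟩
    3 * (2 * k)        ≡⟨ solve 1 (λ k → con 3 :* (con 2 :* k) := con 2 :* (con 3 :* k)) refl k ⟩
    2 * (3 * k)        ∎)
    where
    open ≡-Reasoning
    open +-*-Solver

  2≤k : 2 ≤ k
  2≤k = ℕ.*-cancelˡ-≤ 2 (subst (4 ≤_) order≡ (MatchingCovered.4≤order (proj₁ minimal)))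

  -- A 2-cycle has an ear unless it is the whole digraph; but then G would have
  -- 4 vertices and at least 4 edges, more than (3 · 4 - 6) / 2.
  no-2-cycle : ∀ e f → src e ≢ tgt e → src f ≡ tgt e → tgt f ≢ src e
  no-2-cycle e f x≢y sf tf with any? (λ v → ¬? (v ∈? (src e ∷ tgt e ∷ [])))
  ... | no none = ℕ.<⇒≱ (ℕ.≤-refl {7}) (ℕ.≤-trans (ℕ.+-monoˡ-≤ 3 (Unique-Fin four))
                    (subst (_≤ 6) (sym size≡) (ℕ.*-monoʳ-≤ 3 k≤2)))
    where
    k≤2 : k ≤ 2
    k≤2 = subst (_≤ 2) (length-allFin k) (Unique⇒length≤ {ys = src e ∷ tgt e ∷ []} (allFin⁺ k)
      λ {v} _ → decidable-stable (v ∈? _) (λ v∉ → none (v , v∉)))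

    e≢loop : ∀ {i} → e ≢ loop i
    e≢loop refl = x≢y (trans (src-loop _) (sym (tgt-loop _)))

    f≢loop : ∀ {i} → f ≢ loop i
    f≢loop refl = x≢y (trans (sym tf) (trans (tgt-loop _) (trans (sym (src-loop _)) sf)))

    four : Unique (loop (src e) ∷ loop (tgt e) ∷ e ∷ f ∷ [])
    four = ((λ eq → x≢y (trans (sym (src-loop _)) (trans (cong src eq) (src-loop _))))
             ∷ (e≢loop ∘ sym) ∷ (f≢loop ∘ sym) ∷ [])
         ∷ ((e≢loop ∘ sym) ∷ (f≢loop ∘ sym) ∷ [])
         ∷ ((λ e≡f → x≢y (trans (cong src e≡f) sf)) ∷ []) ∷ [] ∷ []
  ... | yes (v , v∉) with firstExit (_∈? (src e ∷ tgt e ∷ [])) (strong (src e) v) (here refl) v∉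
  ...   | g , _ , here sg≡x , tg∉ = no-ear F minimal e f x≢y sf tf g sg≡x tg∉
  ...   | g , _ , there (here sg≡y) , tg∉ =
    no-ear F minimal f e (λ eq → x≢y (sym (trans (sym sf) (trans eq tf)))) (sym tf) (sym sf) g
      (trans sg≡y (sym sf)) λ { (here eq) → tg∉ (there (here (trans eq sf)))
                              ; (there (here eq)) → tg∉ (here (trans eq tf)) }

  extremal⇒bouquet : Bouquet src tgt
  extremal⇒bouquet = Extremal.bouquet src tgt loop src-loop tgt-loop strong
    (minimal⇒essential F minimal) size≡ 2≤k no-2-cycle

-- The framing given by a perfect matching

module Matching⇒Framing {G : Graph} (bipartite : Bipartite G)
                        {M : Subset (size G)} (perfect : PerfectMatching G M) where
  open Graph G hiding (order; size)

  colour : V → Bool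
  colour = proj₁ bipartite

  proper : ∀ e → colour (proj₁ (ends e)) ≢ colour (proj₂ (ends e))
  proper = proj₂ bipartite

  mate : V → E
  mate v = proj₁ (perfect v)

  mate∈M : ∀ v → mate v ∈ₛ M
  mate∈M v = proj₁ (proj₁ (proj₂ (perfect v)))

  mate-incident : ∀ v → Incident (mate v) v
  mate-incident v = proj₂ (proj₁ (proj₂ (perfect v)))

  mate-unique : ∀ {e v} → e ∈ₛ M → Incident e v → mate v ≡ e
  mate-unique {v = v} e∈ inc = proj₂ (proj₂ (perfect v)) (e∈ , inc)

  split : ∀ e → ∃[ w ] ∃[ b ] Joins e w b × colour w ≡ true × colour b ≡ false
  split e with colour (proj₁ (ends e)) in eq₁ | colour (proj₂ (ends e)) in eq₂
  ... | true  | true  = contradiction (trans eq₁ (sym eq₂)) (proper e)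
  ... | true  | false = _ , _ , inj₁ refl , eq₁ , eq₂
  ... | false | true  = _ , _ , inj₂ refl , eq₂ , eq₁
  ... | false | false = contradiction (trans eq₁ (sym eq₂)) (proper e)

  white black : E → V
  white e = proj₁ (split e)
  black e = proj₁ (proj₂ (split e))

  white-black-joins : ∀ e → Joins e (white e) (black e)
  white-black-joins e = proj₁ (proj₂ (proj₂ (split e)))

  colour-white : ∀ e → colour (white e) ≡ true
  colour-white e = proj₁ (proj₂ (proj₂ (proj₂ (split e))))

  colour-black : ∀ e → colour (black e) ≡ false
  colour-black e = proj₂ (proj₂ (proj₂ (proj₂ (split e))))

  white≡ : ∀ {e v} → Incident e v → colour v ≡ true → white e ≡ v
  white≡ {e} inc c with Incident-ends G (white-black-joins e) inc
  ... | inj₁ refl = refl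
  ... | inj₂ refl with () ← trans (sym c) (colour-black e)

  black≡ : ∀ {e v} → Incident e v → colour v ≡ false → black e ≡ v
  black≡ {e} inc c with Incident-ends G (white-black-joins e) inc
  ... | inj₂ refl = refl
  ... | inj₁ refl with () ← trans (sym c) (colour-white e)

  mate-white : ∀ {e} → e ∈ₛ M → mate (white e) ≡ e
  mate-white {e} e∈ = mate-unique e∈ (Joins-incidentˡ G (white-black-joins e))

  mate-black : ∀ {e} → e ∈ₛ M → mate (black e) ≡ e
  mate-black {e} e∈ = mate-unique e∈ (Joins-incidentʳ G (white-black-joins e))

  whites : List V
  whites = filter (λ v → colour v Bool.≟ true) (allFin (order G))

  colour-whites : ∀ i → colour (lookup whites i) ≡ true
  colour-whites i = proj₂ (∈-filter⁻ (λ v → colour v Bool.≟ true) {xs = allFin (order G)} (∈-lookup i))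

  label : ∀ {v} → colour v ≡ true → ∃[ i ] lookup whites i ≡ v
  label c = let v∈ = ∈-filter⁺ (λ v → colour v Bool.≟ true) (∈-allFin _) c in index v∈ , sym (lookup-index v∈)

  whites-injective : ∀ {i j} → lookup whites i ≡ lookup whites j → i ≡ j
  whites-injective = lookup-injective (filter⁺ (λ v → colour v Bool.≟ true) (allFin⁺ (order G))) _ _

  at : Bool × Fin (length whites) → V
  at (true  , i) = lookup whites i
  at (false , i) = black (mate (lookup whites i))

  white-mate : ∀ i → white (mate (lookup whites i)) ≡ lookup whites i
  white-mate i = white≡ (mate-incident _) (colour-whites i)

  at-injective : Injective _≡_ _≡_ at
  at-injective {true  , i} {true  , j} eq = cong (true ,_) (whites-injective eq)
  at-injective {true  , i} {false , j} eq with () ← trans (sym (colour-whites i)) (trans (cong colour eq) (colour-black _))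
  at-injective {false , i} {true  , j} eq with () ← trans (sym (colour-whites j)) (trans (cong colour (sym eq)) (colour-black _))
  at-injective {false , i} {false , j} eq = cong (false ,_) (whites-injective (begin
    lookup whites i                ≡⟨ white-mate i ⟨
    white (mate (lookup whites i)) ≡⟨ cong white same ⟩
    white (mate (lookup whites j)) ≡⟨ white-mate j ⟩
    lookup whites j                ∎))
    where
    open ≡-Reasoning
    same : mate (lookup whites i) ≡ mate (lookup whites j)
    same = trans (sym (mate-black (mate∈M _))) (trans (cong mate eq) (mate-black (mate∈M _)))

  blackLabel : ∀ {v} → colour v ≡ false → ∃[ i ] at (false , i) ≡ v
  blackLabel {v} c = let i , eq = label (colour-white (mate v)) in i , (begin
    black (mate (lookup whites i))   ≡⟨ cong (black ∘ mate) eq ⟩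
    black (mate (white (mate v)))    ≡⟨ cong black (mate-white (mate∈M v)) ⟩
    black (mate v)                   ≡⟨ black≡ (mate-incident v) c ⟩
    v                                ∎)
    where open ≡-Reasoning

  at-surjective : ∀ v → ∃[ x ] at x ≡ v
  at-surjective v with colour v in c
  ... | true  = let i , eq = label c in (true , i) , eq
  ... | false = let i , eq = blackLabel c in (false , i) , eq

  framing : Framing G
  framing = record
    { k        = length whites
    ; vertex   = bijective⇒↔ at at-injective at-surjective
    ; src      = λ e → proj₁ (label (colour-white e))
    ; tgt      = λ e → proj₁ (blackLabel (colour-black e))
    ; joins    = λ e → subst₂ (Joins e) (sym (proj₂ (label (colour-white e))))
                         (sym (proj₂ (blackLabel (colour-black e)))) (white-black-joins e)
    ; loop     = λ i → mate (lookup whites i)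
    ; src-loop = λ i → whites-injective (trans (proj₂ (label (colour-white _))) (white-mate i))
    ; tgt-loop = λ i → cong proj₂ (at-injective {false , _} {false , i} (proj₂ (blackLabel (colour-black _))))
    }

extremal⇒framing : ∀ {G} → EdgeExtremalMinimalBipartiteMatchingCovered G → Framing G
-- Without edges, extremality would read 6 = 3n with n at least 4.
extremal⇒framing {mkGraph n zero ends loopless} extremal =
  contradiction (subst (12 ≤_) (sym edgeExtremal) (ℕ.*-monoʳ-≤ 3 (MatchingCovered.4≤order (proj₁ minimal))))
    (ℕ.<⇒≱ (ℕ.m≤m+n 7 5))
  where open EdgeExtremalMinimalBipartiteMatchingCovered extremal
extremal⇒framing {mkGraph n (suc m) ends loopless} extremal =
  Matching⇒Framing.framing bipartite (proj₁ (proj₂ (MatchingCovered.covered (proj₁ minimal) zero)))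
  where open EdgeExtremalMinimalBipartiteMatchingCovered extremal

-- Theta graphs

-- Θ p: two hubs joined by p internally disjoint paths of length 3.  Side b
-- has hub (b , zero) and spokes (b , suc i); edge (just b , i) joins hub and
-- spoke on side b, and the rung (nothing , i) joins the two i-th spokes.
ΘVertex ΘEdge : ℕ → Set
ΘVertex p = Bool × Fin (suc p)
ΘEdge   p = Maybe Bool × Fin p

Θends : ∀ {p} → ΘEdge p → ΘVertex p × ΘVertex p
Θends (just b  , i) = (b , zero) , (b , suc i)
Θends (nothing , i) = (false , suc i) , (true , suc i)

record IsΘ (p : ℕ) (G : Graph) : Set where
  open Graph G hiding (order; size)
  field
    vertex : ΘVertex p ↔ V
    edge   : ΘEdge p ↔ E
    joins  : ∀ x → Joins (Inverse.to edge x) (Inverse.to vertex (proj₁ (Θends x))) (Inverse.to vertex (proj₂ (Θends x)))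

  open Inverse vertex public using ()
    renaming (to to at; from to name; strictlyInverseˡ to at-name; strictlyInverseʳ to name-at)
  open Inverse edge public using ()
    renaming (to to edgeAt; from to edgeName; strictlyInverseˡ to edgeAt-name; strictlyInverseʳ to edgeName-at)

-- The theta graph of a bouquet

pointed : ∀ {k} (c : Fin k) → ∃[ p ] Σ[ ω ∈ Fin (suc p) ↔ Fin k ] Inverse.to ω zero ≡ c
pointed {suc p} c = p , transpose zero c , swapped-left zero c

module Bouquet⇒Θ {G : Graph} (F : Framing G)
  (B : Bouquet (Framing.src F) (Framing.tgt F))
  {p : ℕ} (ω : Fin (suc p) ↔ Fin (Framing.k F)) (ω-zero : Inverse.to ω zero ≡ Bouquet.e₀ B) where
  open Graph G hiding (order; size)
  open Framing F
  open Bouquet B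
  open Inverse ω using () renaming (to to ω⁺; from to ω⁻; strictlyInverseˡ to ω⁺ω⁻; strictlyInverseʳ to ω⁻ω⁺)

  spoke : Fin p → Fin k
  spoke i = ω⁺ (suc i)

  -- Black labels are read through this swap so that all paths get the uniform form white `e₀`,
  -- black `τ v`, white `v`, black `τ e₀`, with `v` running over all vertices but `e₀`. For `v = e₁`
  -- the middle edge is the shared arc e₁ → e₀.
  τ : Fin k → Fin k
  τ = swapped e₀ e₁

  ττ : ∀ i → τ (τ i) ≡ i
  ττ i = by-cases (i ≟ e₀) (i ≟ e₁)
    where
    by-cases : Dec (i ≡ e₀) → Dec (i ≡ e₁) → τ (τ i) ≡ i
    by-cases (yes refl) _          = trans (cong τ (swapped-left e₀ e₁)) (swapped-right e₀ e₁)
    by-cases (no _)     (yes refl) = trans (cong τ (swapped-right e₀ e₁)) (swapped-left e₀ e₁)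
    by-cases (no i≢e₀)  (no i≢e₁)  =
      trans (cong τ (swapped-other e₀ e₁ i≢e₀ i≢e₁)) (swapped-other e₀ e₁ i≢e₀ i≢e₁)

  τ-injective : ∀ {i j} → τ i ≡ τ j → i ≡ j
  τ-injective {i} {j} eq = trans (sym (ττ i)) (trans (cong τ eq) (ττ j))

  τe₀ : τ e₀ ≡ e₁
  τe₀ = swapped-left e₀ e₁

  spoke≢e₀ : ∀ i → spoke i ≢ e₀
  spoke≢e₀ i eq with () ← to-injective ω {suc i} {zero} (trans eq (sym ω-zero))

  spoke-injective : ∀ {i j} → spoke i ≡ spoke j → i ≡ j
  spoke-injective eq with refl ← to-injective ω eq = refl

  spoke-surjective : ∀ {v} → v ≢ e₀ → ∃[ i ] spoke i ≡ v
  spoke-surjective {v} v≢e₀ with ω⁻ v | ω⁺ω⁻ v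
  ... | zero  | eq = contradiction (trans (sym eq) ω-zero) v≢e₀
  ... | suc i | eq = i , eq

  paint : Bool → Fin (suc p) → Bool
  paint b zero    = not b
  paint b (suc _) = b

  paint-involutive : ∀ b i → paint (paint b i) i ≡ b
  paint-involutive b zero    = not-involutive b
  paint-involutive b (suc _) = refl

  relabel : Bool → Fin k → Fin k
  relabel true  = id
  relabel false = τ

  relabel-involutive : ∀ c i → relabel c (relabel c i) ≡ i
  relabel-involutive true  i = refl
  relabel-involutive false i = ττ i

  colouring : ΘVertex p ↔ (Bool × Fin k)
  colouring = mk↔ₛ′ to from to-from from-to
    where
    to : ΘVertex p → Bool × Fin k
    to (b , i) = paint b i , relabel (paint b i) (ω⁺ i)

    from : Bool × Fin k → ΘVertex p
    from (c , j) = let i = ω⁻ (relabel c j) in paint c i , i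

    to-from : ∀ x → to (from x) ≡ x
    to-from (c , j) rewrite paint-involutive c (ω⁻ (relabel c j)) | ω⁺ω⁻ (relabel c j) =
      cong (c ,_) (relabel-involutive c j)

    from-to : ∀ x → from (to x) ≡ x
    from-to (b , i) rewrite relabel-involutive (paint b i) (ω⁺ i) | ω⁻ω⁺ i =
      cong (_, i) (paint-involutive b i)

  position : ΘEdge p → Fin k × Fin k
  position (just false , i) = e₀ , τ (spoke i)
  position (just true  , i) = spoke i , τ e₀
  position (nothing    , i) = spoke i , τ (spoke i)

  position-injective : Injective _≡_ _≡_ position
  position-injective {just false , i} {just false , j} eq = cong (just false ,_) (spoke-injective (τ-injective (cong proj₂ eq)))
  position-injective {just true  , i} {just true  , j} eq = cong (just true ,_) (spoke-injective (cong proj₁ eq))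
  position-injective {nothing    , i} {nothing    , j} eq = cong (nothing ,_) (spoke-injective (cong proj₁ eq))
  position-injective {just false , i} {just true  , j} eq = contradiction (sym (cong proj₁ eq)) (spoke≢e₀ j)
  position-injective {just false , i} {nothing    , j} eq = contradiction (sym (cong proj₁ eq)) (spoke≢e₀ j)
  position-injective {just true  , i} {just false , j} eq = contradiction (cong proj₁ eq) (spoke≢e₀ i)
  position-injective {nothing    , i} {just false , j} eq = contradiction (cong proj₁ eq) (spoke≢e₀ i)
  position-injective {just true  , i} {nothing    , j} eq = contradiction (sym (τ-injective (cong proj₂ eq))) (spoke≢e₀ j)
  position-injective {nothing    , i} {just true  , j} eq = contradiction (τ-injective (cong proj₂ eq)) (spoke≢e₀ i)

  At : Fin k × Fin k → E → Set
  At (u , v) e = src e ≡ u × tgt e ≡ v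

  find : ∀ x → ∃[ e ] At (position x) e
  -- The path of `e₁` is exceptional: its hub edges are the loops at `e₀` and `e₁` and its rung is
  -- `back`. On every other path the loop is the rung.
  find (b , i) with spoke i ≟ e₁
  find (just false , i) | yes eq = loop e₀ , src-loop e₀ ,
    trans (tgt-loop e₀) (sym (trans (cong τ eq) (swapped-right e₀ e₁)))
  find (just true  , i) | yes eq = loop e₁ , trans (src-loop e₁) (sym eq) , trans (tgt-loop e₁) (sym τe₀)
  find (nothing    , i) | yes eq with back
  ... | e , s , t = e , trans s (sym eq) , trans t (sym (trans (cong τ eq) (swapped-right e₀ e₁)))
  find (just false , i) | no ≢e₁ with from-e₀ (spoke i) (spoke≢e₀ i) ≢e₁
  ... | e , s , t = e , s , trans t (sym (swapped-other e₀ e₁ (spoke≢e₀ i) ≢e₁))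
  find (just true  , i) | no ≢e₁ with to-e₁ (spoke i) (spoke≢e₀ i) ≢e₁
  ... | e , s , t = e , s , trans t (sym τe₀)
  find (nothing    , i) | no ≢e₁ = loop (spoke i) , src-loop _ ,
    trans (tgt-loop _) (sym (swapped-other e₀ e₁ (spoke≢e₀ i) ≢e₁))

  locate : ∀ e → ∃[ x ] At (position x) e
  locate e with src e ≟ tgt e
  ... | yes s≡t with src e ≟ e₀ | src e ≟ e₁
  ...   | yes s≡e₀ | _ = let i , eq = spoke-surjective (e₀≢e₁ ∘ sym) in
            (just false , i) , s≡e₀ , trans (trans (sym s≡t) s≡e₀) (sym (trans (cong τ eq) (swapped-right e₀ e₁)))
  ...   | no _ | yes s≡e₁ = let i , eq = spoke-surjective (e₀≢e₁ ∘ sym) in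
            (just true , i) , trans s≡e₁ (sym eq) , trans (trans (sym s≡t) s≡e₁) (sym τe₀)
  ...   | no s≢e₀ | no s≢e₁ = let i , eq = spoke-surjective s≢e₀ in
            (nothing , i) , sym eq , trans (sym s≡t) (sym (trans (cong τ eq) (swapped-other e₀ e₁ s≢e₀ s≢e₁)))
  locate e | no s≢t with classify e s≢t
  ... | inj₁ (s , t) = let i , eq = spoke-surjective (e₀≢e₁ ∘ sym) in
            (nothing , i) , trans s (sym eq) , trans t (sym (trans (cong τ eq) (swapped-right e₀ e₁)))
  ... | inj₂ (inj₁ (s , t≢e₀ , t≢e₁)) = let i , eq = spoke-surjective t≢e₀ in
            (just false , i) , s , sym (trans (cong τ eq) (swapped-other e₀ e₁ t≢e₀ t≢e₁))
  ... | inj₂ (inj₂ (t , s≢e₀ , _)) = let i , eq = spoke-surjective s≢e₀ in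
            (just true , i) , sym eq , trans t (sym τe₀)

  edgeOf : ΘEdge p → E
  edgeOf x = proj₁ (find x)

  at-position : ∀ x → Joins (edgeOf x) (at (true , proj₁ (position x))) (at (false , proj₂ (position x)))
  at-position x = subst₂ (λ u v → Joins (edgeOf x) (at (true , u)) (at (false , v)))
    (proj₁ (proj₂ (find x))) (proj₂ (proj₂ (find x))) (joins (edgeOf x))

  isΘ : IsΘ p G
  isΘ = record
    { vertex = ↔-trans colouring vertex
    ; edge   = bijective⇒↔ edgeOf injective surjective
    ; joins  = joins′
    }
    where
    injective : Injective _≡_ _≡_ edgeOf
    injective {x} {y} eq = position-injective (cong₂ _,_
      (trans (sym (proj₁ (proj₂ (find x)))) (trans (cong src eq) (proj₁ (proj₂ (find y)))))
      (trans (sym (proj₂ (proj₂ (find x)))) (trans (cong tgt eq) (proj₂ (proj₂ (find y))))))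

    surjective : ∀ e → ∃[ x ] edgeOf x ≡ e
    -- `find` may return another edge at the position of `e`; by `simple` a position determines its
    -- edge.
    surjective e = let x , s , t = locate e in x ,
      simple (edgeOf x) e (trans (proj₁ (proj₂ (find x))) (sym s)) (trans (proj₂ (proj₂ (find x))) (sym t))

    hub-spoke : ∀ {e c v} → Joins e (at (c , e₀)) v → Joins e (at (c , ω⁺ zero)) v
    hub-spoke {e} {c} {v} = subst (λ u → Joins e (at (c , u)) v) (sym ω-zero)

    joins′ : ∀ x → Joins (edgeOf x) (at (Inverse.to colouring (proj₁ (Θends x))))
                                    (at (Inverse.to colouring (proj₂ (Θends x))))
    joins′ (just false , i) = hub-spoke (at-position (just false , i))
    joins′ (just true  , i) = subst (λ u → Joins (edgeOf (just true , i)) (at (false , τ u)) (at (true , spoke i))) (sym ω-zero)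
                                (Joins-sym G (at-position (just true , i)))
    joins′ (nothing    , i) = Joins-sym G (at-position (nothing , i))

extremal⇒Θ : ∀ {G} → EdgeExtremalMinimalBipartiteMatchingCovered G → ∃[ p ] 2 ≤ p × IsΘ p G
extremal⇒Θ extremal =
  let F = extremal⇒framing extremal
      B = extremal⇒bouquet F extremal
      open Bouquet B
      p , ω , ω-zero = pointed e₀
      -- The third vertex `x` provides the second path: `suc p = k` is at least 3.
      three : Unique (e₀ ∷ e₁ ∷ x ∷ [])
      three = (e₀≢e₁ ∷ (x≢e₀ ∘ sym) ∷ []) ∷ ((x≢e₁ ∘ sym) ∷ []) ∷ [] ∷ []
  in p , s≤s⁻¹ (subst (3 ≤_) (sym (↔⇒≡ ω)) (Unique-Fin three)) , Bouquet⇒Θ.isΘ F B ω ω-zero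

-- Theta graphs are extremal

3↔Maybe-Bool : Fin 3 ↔ Maybe Bool
3↔Maybe-Bool = mk↔ₛ′ (λ { 0F → nothing ; 1F → just false ; 2F → just true })
                     (λ { nothing → 0F ; (just false) → 1F ; (just true) → 2F })
                     (λ { nothing → refl ; (just false) → refl ; (just true) → refl })
                     (λ { 0F → refl ; 1F → refl ; 2F → refl })

-- With `e` deleted, `g` is the only edge left at `v`, so every perfect matching contains it. The
-- one through `h` therefore contains two edges at `w`, which must coincide.
pendant : ∀ {G} e → MatchingCovered (deleteEdge G e) → (let open Graph G) → ∀ {v w g h} →
  g ≢ e → Incident g v → Incident g w → (∀ f → f ≢ e → Incident f v → f ≡ g) →
  h ≢ e → Incident h w → h ≡ g
pendant {mkGraph n zero ends loopless} ()
pendant {G@(mkGraph n (suc m) ends loopless)} e mc {v} {w} {g} {h} g≢e gv gw only-g h≢e hw =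
  begin
    h             ≡⟨ punchIn-punchOut _ ⟨
    punchIn e h⁻  ≡⟨ cong (punchIn e) (unique-w (h∈ , restore (punchIn-punchOut _) hw)) ⟨
    punchIn e m-w ≡⟨ cong (punchIn e) (unique-w (g∈ , restore (punchIn-punchOut _) gw)) ⟩
    punchIn e g⁻  ≡⟨ punchIn-punchOut _ ⟩
    g             ∎
  where
  open ≡-Reasoning
  open Graph G using (Incident)

  g⁻ h⁻ : Fin m
  g⁻ = punchOut (g≢e ∘ sym)
  h⁻ = punchOut (h≢e ∘ sym)

  M,perfect,h∈ = MatchingCovered.covered mc h⁻
  M = proj₁ M,perfect,h∈
  perfect = proj₁ (proj₂ M,perfect,h∈)
  h∈ = proj₂ (proj₂ M,perfect,h∈)

  m-v m-w : Fin m
  m-v = proj₁ (perfect v)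
  m-w = proj₁ (perfect w)

  unique-w : ∀ {f} → f ∈ₛ M × Incident (punchIn e f) w → m-w ≡ f
  unique-w = proj₂ (proj₂ (perfect w))

  restore : ∀ {f f′ u} → f ≡ f′ → Incident f′ u → Incident f u
  restore refl inc = inc

  m-v≡g⁻ : m-v ≡ g⁻
  m-v≡g⁻ = punchIn-injective e _ _ (trans
    (only-g (punchIn e m-v) (punchInᵢ≢i e m-v) (proj₂ (proj₁ (proj₂ (perfect v)))))
    (sym (punchIn-punchOut _)))

  g∈ : g⁻ ∈ₛ M
  g∈ = subst (_∈ₛ M) m-v≡g⁻ (proj₁ (proj₁ (proj₂ (perfect v))))

another : ∀ {p} → 2 ≤ p → (i : Fin p) → ∃[ j ] j ≢ i
another (s≤s (s≤s _)) zero    = 1F , λ ()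
another (s≤s (s≤s _)) (suc i) = 0F , λ ()

module Θ⇒Extremal {p : ℕ} {G : Graph} (2≤p : 2 ≤ p) (T : IsΘ p G) where
  open Graph G hiding (order; size)
  open IsΘ T

  Endpoint : ΘEdge p → ΘVertex p → Set
  Endpoint x y = y ≡ proj₁ (Θends x) ⊎ y ≡ proj₂ (Θends x)

  endpoint-incident : ∀ {x y} → Endpoint x y → Incident (edgeAt x) (at y)
  endpoint-incident {x} (inj₁ refl) = Joins-incidentˡ G (joins x)
  endpoint-incident {x} (inj₂ refl) = Joins-incidentʳ G (joins x)

  incident-endpoint : ∀ {e y} → Incident e (at y) → Endpoint (edgeName e) y
  incident-endpoint {e} inc with Incident-ends G (joins (edgeName e)) (subst (λ f → Incident f _) (sym (edgeAt-name e)) inc)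
  ... | inj₁ eq = inj₁ (to-injective vertex eq)
  ... | inj₂ eq = inj₂ (to-injective vertex eq)

  shade : ΘVertex p → Bool
  shade (b , zero)  = b
  shade (b , suc _) = not b

  bipartite : Bipartite G
  bipartite = shade ∘ name , λ e → proper (edgeName e) (subst (λ f → Joins f _ _) (edgeAt-name e) (joins (edgeName e)))
    where
    shades-differ : ∀ x → shade (proj₁ (Θends x)) ≢ shade (proj₂ (Θends x))
    shades-differ (just false , i) ()
    shades-differ (just true  , i) ()
    shades-differ (nothing    , i) ()

    proper : ∀ x {e} → Joins e (at (proj₁ (Θends x))) (at (proj₂ (Θends x))) →
             shade (name (proj₁ (ends e))) ≢ shade (name (proj₂ (ends e)))
    proper x (inj₁ eq) same rewrite eq | name-at (proj₁ (Θends x)) | name-at (proj₂ (Θends x)) = shades-differ x same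
    proper x (inj₂ eq) same rewrite eq | name-at (proj₁ (Θends x)) | name-at (proj₂ (Θends x)) = shades-differ x (sym same)

  order-Θ : order G ≡ 2 * suc p
  order-Θ = ↔⇒≡ (↔-trans (↔-sym vertex) (↔-trans (↔-sym 2↔Bool ×-↔ ↔-refl) (↔-sym *↔×)))

  size-Θ : size G ≡ 3 * p
  size-Θ = ↔⇒≡ (↔-trans (↔-sym edge) (↔-trans (↔-sym 3↔Maybe-Bool ×-↔ ↔-refl) (↔-sym *↔×)))

  connected : Connected G
  connected u v = subst₂ Walk (at-name u) (at-name v) (toHub (name u) ◅◅ Walk-sym G (toHub (name v)))
    where
    link : ∀ x → Walk (at (proj₁ (Θends x))) (at (proj₂ (Θends x)))
    link x = (edgeAt x , joins x) ◅ ε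

    some : Fin p
    some = fromℕ< 2≤p

    spokeToHub : ∀ i → Walk (at (true , suc i)) (at (false , zero))
    spokeToHub i = Walk-sym G (link (nothing , i)) ◅◅ Walk-sym G (link (just false , i))

    toHub : ∀ y → Walk (at y) (at (false , zero))
    toHub (false , zero)  = ε
    toHub (false , suc i) = Walk-sym G (link (just false , i))
    toHub (true  , suc i) = spokeToHub i
    toHub (true  , zero)  = link (just true , some) ◅◅ spokeToHub some

  -- The i-th of `p` perfect matchings: both hubs are matched along path i, and every other path
  -- contributes its rung. A rung is thus covered by the matching of any other path, which exists
  -- since `2 ≤ p`.
  InMatching : Fin p → ΘEdge p → Set
  InMatching i (just _  , j) = j ≡ i
  InMatching i (nothing , j) = j ≢ i

  inMatching? : ∀ i → Decidable (InMatching i ∘ edgeName)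
  inMatching? i e with edgeName e
  ... | just _  , j = j ≟ i
  ... | nothing , j = ¬? (j ≟ i)

  partner : ∀ i y → ∃[ x ] InMatching i x × Endpoint x y × (∀ x′ → InMatching i x′ → Endpoint x′ y → x ≡ x′)
  partner i (b , zero) = (just b , i) , refl , inj₁ refl , unique
    where
    unique : ∀ x′ → InMatching i x′ → Endpoint x′ (b , zero) → (just b , i) ≡ x′
    unique (just _  , _) refl (inj₁ refl) = refl
    unique (nothing , _) _    (inj₁ ())
    unique (nothing , _) _    (inj₂ ())
  partner i (b , suc j) with j ≟ i
  ... | yes refl = (just b , i) , refl , inj₂ refl , unique
    where
    unique : ∀ x′ → InMatching i x′ → Endpoint x′ (b , suc i) → (just b , i) ≡ x′
    unique (just _  , _) refl (inj₂ refl) = refl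
    unique (nothing , _) j≢i  (inj₁ refl) = contradiction refl j≢i
    unique (nothing , _) j≢i  (inj₂ refl) = contradiction refl j≢i
  ... | no j≢i = (nothing , j) , j≢i , on-rung b , unique b
    where
    on-rung : ∀ b → Endpoint (nothing , j) (b , suc j)
    on-rung false = inj₁ refl
    on-rung true  = inj₂ refl

    unique : ∀ b x′ → InMatching i x′ → Endpoint x′ (b , suc j) → (nothing , j) ≡ x′
    unique b (just _  , _) refl (inj₂ refl) = contradiction refl j≢i
    unique b (nothing , _) _    (inj₁ refl) = refl
    unique b (nothing , _) _    (inj₂ refl) = refl

  perfect : ∀ i → PerfectMatching G (subset (inMatching? i))
  perfect i v = subst Matched (at-name v) (matched (name v))
    where
    Matched : V → Set
    Matched v = ∃[ e ] (e ∈ₛ subset (inMatching? i) × Incident e v) ×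
                (∀ {f} → f ∈ₛ subset (inMatching? i) × Incident f v → e ≡ f)

    matched : ∀ y → Matched (at y)
    matched y = let x , x∈ , x-y , unique = partner i y in
      edgeAt x , (∈-subset⁺ (inMatching? i) (subst (InMatching i) (sym (edgeName-at x)) x∈) , endpoint-incident x-y) ,
      λ {f} (f∈ , inc) → trans (cong edgeAt (unique (edgeName f) (∈-subset⁻ (inMatching? i) f∈) (incident-endpoint inc)))
                               (edgeAt-name f)

  in-some : ∀ x → ∃[ i ] InMatching i x
  in-some (just _  , j) = j , refl
  in-some (nothing , j) = let i , i≢j = another 2≤p j in i , i≢j ∘ sym

  matchingCovered : MatchingCovered G
  matchingCovered = record
    { 4≤order   = subst (4 ≤_) (sym order-Θ) (ℕ.*-monoʳ-≤ 2 (ℕ.≤-trans 2≤p (ℕ.n≤1+n p)))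
    ; connected = connected
    ; covered   = λ e → let i , e∈ = in-some (edgeName e) in _ , perfect i , ∈-subset⁺ (inMatching? i) e∈
    }

  -- Deleting an edge makes some spoke y pendant, and its only remaining edge g
  -- shares an endpoint z with another edge h.
  isolates : ∀ x → ∃[ y ] ∃[ z ] ∃[ g ] ∃[ h ]
    g ≢ x × Endpoint g y × Endpoint g z × (∀ f → f ≢ x → Endpoint f y → f ≡ g) × h ≢ x × Endpoint h z × h ≢ g
  isolates (just b , i) = (b , suc i) , (not b , suc i) , (nothing , i) , (just (not b) , i) ,
    (λ ()) , on-rung b , on-rung (not b) , only , (λ eq → not-¬ refl (sym (just-injective (cong proj₁ eq)))) , inj₂ refl , λ ()
    where
    on-rung : ∀ b → Endpoint (nothing , i) (b , suc i)
    on-rung false = inj₁ refl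
    on-rung true  = inj₂ refl

    only : ∀ f → f ≢ (just b , i) → Endpoint f (b , suc i) → f ≡ (nothing , i)
    only (just _  , _) f≢ (inj₂ refl) = contradiction refl f≢
    only (nothing , _) _  (inj₁ refl) = refl
    only (nothing , _) _  (inj₂ refl) = refl
  isolates (nothing , i) = let j , j≢i = another 2≤p i in
    (false , suc i) , (false , zero) , (just false , i) , (just false , j) ,
    (λ ()) , inj₂ refl , inj₁ refl , only , (λ ()) , inj₁ refl , j≢i ∘ cong proj₂
    where
    only : ∀ f → f ≢ (nothing , i) → Endpoint f (false , suc i) → f ≡ (just false , i)
    only (just _  , _) _  (inj₂ refl) = refl
    only (nothing , _) f≢ (inj₁ refl) = contradiction refl f≢

  irremovable : ∀ e → ¬ MatchingCovered (deleteEdge G e)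
  irremovable e mc =
    let y , z , g , h , g≢ , gy , gz , only , h≢ , hz , h≢g = isolates (edgeName e)
        kept : ∀ {x} → x ≢ edgeName e → edgeAt x ≢ e
        kept x≢ eq = x≢ (trans (sym (edgeName-at _)) (cong edgeName eq))
    in h≢g (to-injective edge (pendant {G} e mc (kept g≢) (endpoint-incident gy) (endpoint-incident gz)
         (λ f f≢e fy → trans (sym (edgeAt-name f)) (cong edgeAt
            (only (edgeName f) (λ eq → f≢e (to-injective (↔-sym edge) eq)) (incident-endpoint fy))))
         (kept h≢) (endpoint-incident hz)))

  extremal : EdgeExtremalMinimalBipartiteMatchingCovered G
  extremal = record
    { minimal      = matchingCovered , irremovable
    ; bipartite    = bipartite
    ; edgeExtremal = begin
        2 * size G + 6       ≡⟨ cong (λ m → 2 * m + 6) size-Θ ⟩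
        2 * (3 * p) + 6      ≡⟨ solve 1 (λ p → con 2 :* (con 3 :* p) :+ con 6 := con 3 :* (con 2 :* (con 1 :+ p))) refl p ⟩
        3 * (2 * suc p)      ≡⟨ cong (3 *_) order-Θ ⟨
        3 * order G          ∎
    }
    where
    open ≡-Reasoning
    open +-*-Solver

-- Isomorphisms and uniqueness of theta graphs

module _ {G H : Graph} (f : G ≅ H) where
  private
    module G = Graph G
    module H = Graph H
  open _≅_ f
  open Inverse vertices using () renaming (to to v⁺; from to v⁻; strictlyInverseʳ to v⁻v⁺)
  open Inverse edges using () renaming (to to e⁺; from to e⁻; strictlyInverseˡ to e⁺e⁻)

  ≅-Joins : ∀ {e u v} → G.Joins e u v → H.Joins (e⁺ e) (v⁺ u) (v⁺ v)
  ≅-Joins {e} (inj₁ eq) = subst₂ (λ a b → H.Joins (e⁺ e) (v⁺ a) (v⁺ b)) (cong proj₁ eq) (cong proj₂ eq) (respects e)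
  ≅-Joins {e} (inj₂ eq) = Joins-sym H (subst₂ (λ a b → H.Joins (e⁺ e) (v⁺ a) (v⁺ b)) (cong proj₁ eq) (cong proj₂ eq) (respects e))

  ≅-sym : H ≅ G
  ≅-sym = record
    { vertices = ↔-sym vertices
    ; edges    = ↔-sym edges
    ; respects = λ e → pull (subst (λ e′ → H.Joins e′ _ _) (e⁺e⁻ e) (respects (e⁻ e)))
    }
    where
    pull : ∀ {e e′} → H.Joins e (v⁺ (proj₁ (G.ends e′))) (v⁺ (proj₂ (G.ends e′))) →
           G.Joins e′ (v⁻ (proj₁ (H.ends e))) (v⁻ (proj₂ (H.ends e)))
    pull (inj₁ eq) = inj₁ (sym (cong₂ _,_ (trans (cong (v⁻ ∘ proj₁) eq) (v⁻v⁺ _)) (trans (cong (v⁻ ∘ proj₂) eq) (v⁻v⁺ _))))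
    pull (inj₂ eq) = inj₂ (sym (cong₂ _,_ (trans (cong (v⁻ ∘ proj₂) eq) (v⁻v⁺ _)) (trans (cong (v⁻ ∘ proj₁) eq) (v⁻v⁺ _))))

≅-refl : ∀ {G} → G ≅ G
≅-refl = record { vertices = ↔-refl ; edges = ↔-refl ; respects = λ _ → inj₁ refl }

Θ-resp-≅ : ∀ {p G H} → G ≅ H → IsΘ p H → IsΘ p G
Θ-resp-≅ f T = record
  { vertex = ↔-trans vertex (↔-sym (_≅_.vertices f))
  ; edge   = ↔-trans edge (↔-sym (_≅_.edges f))
  ; joins  = λ x → ≅-Joins (≅-sym f) (joins x)
  }
  where open IsΘ T

-- Both graphs carry the same labels with the same incidences, so matching labels is an isomorphism;
-- only the order of the two ends of an edge may differ.
Θ-unique : ∀ {p G H} → IsΘ p G → IsΘ p H → G ≅ H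
Θ-unique {G = G} {H} S T = record
  { vertices = ↔-trans (↔-sym S.vertex) T.vertex
  ; edges    = ↔-trans (↔-sym S.edge) T.edge
  ; respects = λ e → push (S.edgeName e) (subst (λ e′ → G.Joins e′ _ _) (S.edgeAt-name e) (S.joins (S.edgeName e)))
  }
  where
  module S = IsΘ S
  module T = IsΘ T
  module G = Graph G
  module H = Graph H
  push : ∀ x {e} → G.Joins e (S.at (proj₁ (Θends x))) (S.at (proj₂ (Θends x))) →
         H.Joins (T.edgeAt x) (T.at (S.name (proj₁ (G.ends e)))) (T.at (S.name (proj₂ (G.ends e))))
  push x (inj₁ eq) rewrite eq | S.name-at (proj₁ (Θends x)) | S.name-at (proj₂ (Θends x)) = T.joins x
  push x (inj₂ eq) rewrite eq | S.name-at (proj₁ (Θends x)) | S.name-at (proj₂ (Θends x)) = Joins-sym H (T.joins x)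

-- Leaf matching of stars

module StarLeaves {p : ℕ} (2≤p : 2 ≤ p) {T : Graph} (ψ : T ≅ K₁, p) where
  open Graph T hiding (order; size)
  open Inverse (_≅_.vertices ψ) public using ()
    renaming (to to name; from to at; strictlyInverseˡ to name-at; strictlyInverseʳ to at-name)
  open Inverse (_≅_.edges ψ) public using () renaming (from to ray; strictlyInverseʳ to ray-name)

  ray-joins : ∀ i → Joins (ray i) (at zero) (at (suc i))
  ray-joins i = ≅-Joins (≅-sym ψ) (inj₁ refl)

  at-injective : ∀ {i j} → at i ≡ at j → i ≡ j
  at-injective = to-injective (↔-sym (_≅_.vertices ψ))

  ray-injective : ∀ {i j} → ray i ≡ ray j → i ≡ j
  ray-injective = to-injective (↔-sym (_≅_.edges ψ))

  rays-at : V → List E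
  rays-at v = filter (incident? v) (allFin (size T))

  incident⇒∈rays : ∀ {e v} → Incident e v → e ∈ rays-at v
  incident⇒∈rays {v = v} inc = ∈-filter⁺ (incident? v) (∈-allFin _) inc

  spoke-rays : ∀ i → rays-at (at (suc i)) ⊆ ray i ∷ []
  spoke-rays i {e} e∈ = here (trans (sym (ray-name e)) (only (Inverse.to (_≅_.edges ψ) e)
    (subst (λ f → Incident f _) (sym (ray-name e)) (proj₂ (∈-filter⁻ (incident? (at (suc i))) {xs = allFin (size T)} e∈)))))
    where
    only : ∀ j → Incident (ray j) (at (suc i)) → ray j ≡ ray i
    only j inc with Incident-ends T (ray-joins j) inc
    ... | inj₁ eq with () ← at-injective eq
    ... | inj₂ eq with refl ← at-injective eq = refl

  spoke-degree : ∀ i → degree (at (suc i)) ≡ 1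
  spoke-degree i = ℕ.≤-antisym
    (Unique⇒length≤ (filter⁺ (incident? (at (suc i))) (allFin⁺ (size T))) (spoke-rays i))
    (∈-length (incident⇒∈rays (Joins-incidentʳ T (ray-joins i))))

  -- With a single ray the centre would be a leaf too, and leaf matching would add an edge between
  -- the two centres. Two distinct rays rule this out, so the leaves are exactly the outer vertices.
  centre-degree : degree (at zero) ≢ 1
  centre-degree eq = ℕ.<⇒≱ ℕ.≤-refl (subst (2 ≤_) eq two)
    where
    i₀ = fromℕ< 2≤p
    i₁ = proj₁ (another 2≤p i₀)

    at-centre : ∀ {e} → e ∈ ray i₁ ∷ ray i₀ ∷ [] → e ∈ rays-at (at zero)
    at-centre (here refl)         = incident⇒∈rays (Joins-incidentˡ T (ray-joins i₁))
    at-centre (there (here refl)) = incident⇒∈rays (Joins-incidentˡ T (ray-joins i₀))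

    two : 2 ≤ degree (at zero)
    two = Unique⇒length≤ ((proj₂ (another 2≤p i₀) ∘ ray-injective ∷ []) ∷ [] ∷ []) at-centre

  leaf? : ∀ v → Dec (degree v ≡ 1)
  leaf? v = degree v ℕ.≟ 1

  spoke∈leaves : ∀ i → at (suc i) ∈ leaves
  spoke∈leaves i = ∈-filter⁺ leaf? (∈-allFin _) (spoke-degree i)

  leaf : Fin p → Fin (length leaves)
  leaf i = index (spoke∈leaves i)

  lookup-leaf : ∀ i → lookup leaves (leaf i) ≡ at (suc i)
  lookup-leaf i = sym (lookup-index (spoke∈leaves i))

  leaf-injective : ∀ {i j} → leaf i ≡ leaf j → i ≡ j
  leaf-injective {i} {j} eq
    with refl ← at-injective (trans (sym (lookup-leaf i)) (trans (cong (lookup leaves) eq) (lookup-leaf j))) = refl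

  leaf-surjective : ∀ ℓ → ∃[ i ] leaf i ≡ ℓ
  leaf-surjective ℓ with name (lookup leaves ℓ) | at-name (lookup leaves ℓ)
                       | proj₂ (∈-filter⁻ leaf? {xs = allFin (order T)} (∈-lookup {xs = leaves} ℓ))
  ... | zero  | eq | deg = contradiction (trans (cong degree eq) deg) centre-degree
  ... | suc i | eq | _   = i , lookup-injective (filter⁺ leaf? (allFin⁺ (order T))) _ _ (trans (lookup-leaf i) eq)

module StarLeafMatching {p : ℕ} (2≤p : 2 ≤ p) {T T′ : Graph} (ψ : T ≅ K₁, p) (φ : T ≅ T′) where
  open StarLeaves 2≤p ψ
  open LeafMatching T T′ φ
  private
    module T  = Graph T
    module T′ = Graph T′
    module L  = Graph graph

  copy : T.V → T′.V
  copy = Inverse.to (_≅_.vertices φ)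

  copyEdge : T.E → T′.E
  copyEdge = Inverse.to (_≅_.edges φ)

  sides : (T.V ⊎ T′.V) ↔ L.V
  sides = ↔-sym +↔⊎

  parts : (T.E ⊎ T′.E ⊎ Leaf) ↔ L.E
  parts = ↔-sym (↔-trans +↔⊎ (↔-refl ⊎-↔ +↔⊎))

  split-parts : ∀ x → split (Inverse.to parts x) ≡ x
  split-parts = Inverse.strictlyInverseʳ parts

  place : ΘVertex p → T.V ⊎ T′.V
  place (false , i) = inj₁ (at i)
  place (true  , i) = inj₂ (copy (at i))

  place-injective : Injective _≡_ _≡_ place
  place-injective {false , i} {false , j} eq = cong (false ,_) (at-injective (inj₁-injective eq))
  place-injective {true  , i} {true  , j} eq =
    cong (true ,_) (at-injective (to-injective (_≅_.vertices φ) (inj₂-injective eq)))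

  place-surjective : ∀ v → ∃[ y ] place y ≡ v
  place-surjective (inj₁ v) = (false , name v) , cong inj₁ (at-name v)
  place-surjective (inj₂ v) = (true , name (Inverse.from (_≅_.vertices φ) v)) ,
    cong inj₂ (trans (cong copy (at-name _)) (Inverse.strictlyInverseˡ (_≅_.vertices φ) v))

  placeEdge : ΘEdge p → T.E ⊎ T′.E ⊎ Leaf
  placeEdge (just false , i) = inj₁ (ray i)
  placeEdge (just true  , i) = inj₂ (inj₁ (copyEdge (ray i)))
  placeEdge (nothing    , i) = inj₂ (inj₂ (leaf i))

  placeEdge-injective : Injective _≡_ _≡_ placeEdge
  placeEdge-injective {just false , i} {just false , j} eq = cong (just false ,_) (ray-injective (inj₁-injective eq))
  placeEdge-injective {just true  , i} {just true  , j} eq =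
    cong (just true ,_) (ray-injective (to-injective (_≅_.edges φ) (inj₁-injective (inj₂-injective eq))))
  placeEdge-injective {nothing    , i} {nothing    , j} eq =
    cong (nothing ,_) (leaf-injective (inj₂-injective (inj₂-injective eq)))

  placeEdge-injective {nothing    , _} {just false , _} ()
  placeEdge-injective {nothing    , _} {just true  , _} ()

  placeEdge-surjective : ∀ e → ∃[ x ] placeEdge x ≡ e
  placeEdge-surjective (inj₁ e) = (just false , _) , cong inj₁ (ray-name e)
  placeEdge-surjective (inj₂ (inj₁ e)) = (just true , _) ,
    cong (inj₂ ∘ inj₁) (trans (cong copyEdge (ray-name _)) (Inverse.strictlyInverseˡ (_≅_.edges φ) e))
  placeEdge-surjective (inj₂ (inj₂ ℓ)) = let i , eq = leaf-surjective ℓ in (nothing , i) , cong (inj₂ ∘ inj₂) eq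

  Ends : ∀ {A : Set} → A × A → A → A → Set
  Ends e u v = e ≡ (u , v) ⊎ e ≡ (v , u)

  placed-joins : ∀ x → Ends (endsOf (placeEdge x)) (Inverse.to sides (place (proj₁ (Θends x)))) (Inverse.to sides (place (proj₂ (Θends x))))
  placed-joins (just false , i) with ray-joins i
  ... | inj₁ eq = inj₁ (cong (λ (u , v) → left u , left v) eq)
  ... | inj₂ eq = inj₂ (cong (λ (u , v) → left u , left v) eq)
  placed-joins (just true  , i) with ≅-Joins φ (ray-joins i)
  ... | inj₁ eq = inj₁ (cong (λ (u , v) → right u , right v) eq)
  ... | inj₂ eq = inj₂ (cong (λ (u , v) → right u , right v) eq)
  placed-joins (nothing    , i) = inj₁ (cong (λ v → left v , right (copy v)) (lookup-leaf i))

  isΘ : IsΘ p graph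
  isΘ = record
    { vertex = ↔-trans (bijective⇒↔ place place-injective place-surjective) sides
    ; edge   = ↔-trans (bijective⇒↔ placeEdge placeEdge-injective placeEdge-surjective) parts
    ; joins  = λ x → subst (λ e → Ends (endsOf e) (Inverse.to sides (place (proj₁ (Θends x)))) (Inverse.to sides (place (proj₂ (Θends x))))) (sym (split-parts (placeEdge x))) (placed-joins x)
    }

K₁,-tree : ∀ {p} → 1 ≤ p → Tree (K₁, p)
K₁,-tree {p} 1≤p = record { 2≤order = s≤s 1≤p ; connected = connected ; acyclic = acyclic }
  where
  open Graph (K₁, p) hiding (order; size)

  connected : Connected (K₁, p)
  connected u v = toCentre u ◅◅ Walk-sym (K₁, p) (toCentre v)
    where
    toCentre : ∀ v → Walk v zero
    toCentre zero    = ε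
    toCentre (suc i) = (i , inj₂ refl) ◅ ε

  -- A closed walk must turn back at every outer vertex along the edge it came by.
  acyclic : Acyclic (K₁, p)
  acyclic ε (nonempty , _) = nonempty refl
  acyclic {zero} ((_ , inj₁ refl) ◅ (_ , inj₂ refl) ◅ w) (_ , ((e≢f ∷ _) ∷ _) , _) = e≢f refl
  acyclic {suc i} ((_ , inj₂ refl) ◅ (_ , inj₁ refl) ◅ ε) (_ , ((e≢f ∷ _) ∷ _) , _) = e≢f refl
  acyclic {suc i} ((_ , inj₂ refl) ◅ (_ , inj₁ refl) ◅ (_ , inj₂ refl) ◅ w) (_ , (_ ∷ (e≢f ∷ _) ∷ _) , _) = e≢f refl

theorem1p5 : (G : Graph) →
    EdgeExtremalMinimalBipartiteMatchingCovered G
    ⇔ (∃[ T ] IsStar T × G IsObtainedByIsomorphicLeafMatchingFrom T)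
theorem1p5 G = mk⇔ forward backward
  where
  forward : EdgeExtremalMinimalBipartiteMatchingCovered G → ∃[ T ] IsStar T × G IsObtainedByIsomorphicLeafMatchingFrom T
  forward extremal =
    let p , 2≤p , Θ = extremal⇒Θ extremal
    in K₁, p , (p , 2≤p , ≅-refl) , K₁,-tree (ℕ.<⇒≤ 2≤p) , K₁, p , ≅-refl ,
       Θ-unique Θ (StarLeafMatching.isΘ 2≤p ≅-refl ≅-refl)

  backward : ∃[ T ] IsStar T × G IsObtainedByIsomorphicLeafMatchingFrom T → EdgeExtremalMinimalBipartiteMatchingCovered G
  backward (T , (p , 2≤p , ψ) , _ , T′ , φ , G≅) =
    Θ⇒Extremal.extremal 2≤p (Θ-resp-≅ G≅ (StarLeafMatching.isΘ 2≤p ψ φ))
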